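{- Let $\ell>2$ be an integer. A partition $\lambda$ is an $(\ell,0)$-JM partition if and only if it is a generalized $\ell$-partition.
   Context: Partitions are identified with their Young diagrams; $(x,y)$ is the box in row $x$, column $y$. The hook length $h^\lambda_{(a,c)}$ of a box $(a,c)\in\lambda$ is the number of boxes of $\lambda$ to the right of it in its row or below it in its column, including itself. A partition $\lambda$ is an $(\ell,0)$-JM partition if there do NOT exist boxes $(a,b)$, $(a,y)$, $(x,b)$ in $\lambda$ with $\ell\mid h^\lambda_{(a,b)}$, $\ell\nmid h^\lambda_{(a,y)}$, $\ell\nmid h^\lambda_{(x,b)}$. An $\ell$-rim hook of a partition is a connected set of $\ell$ boxes of its Young diagram containing no $2\times2$ square whose removal leaves the Young diagram of a partition; it is horizontal if contained in one row and vertical if contained in one column. Two sets of boxes are adjacent if some box of one shares an edge with some box of the other. A partition $\lambda$ is a generalized $\ell$-partition if: (1) every $\ell$-rim hook of $\lambda$ is horizontal or vertical; (2) for any vertical (resp. horizontal) $\ell$-rim hook $R$ of $\lambda$ and any horizontal (resp. vertical) $\ell$-rim hook $S$ of the partition $\lambda\setminus R$, $R$ and $S$ are not adjacent; (3) every partition obtained from $\lambda$ by successively removing any set of horizontal and vertical $\ell$-rim hooks also satisfies (1) and (2). -}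

module Defs where

open import Data.Nat using (ℕ; zero; suc; _+_; _∸_; _≤_; _<_)
open import Data.Nat.Divisibility using (_∣_)
open import Data.List using (List; []; _∷_)
open import Data.Nat.ListAction using (sum)
open import Data.List.Relation.Unary.All using (All)
open import Data.List.Relation.Unary.Linked using (Linked)
open import Data.Product using (Σ; _×_; _,_; ∃; proj₁)
open import Data.Sum using (_⊎_)
open import Relation.Nullary using (¬_)
open import Relation.Binary.PropositionalEquality using (_≡_)
open import Relation.Binary.Construct.Closure.ReflexiveTransitive using (Star)

-- Partitions (rows listed top to bottom, all parts positive, weakly
-- decreasing).  Rows and columns are indexed from 0 (the paper uses 1;
-- all notions below are translation invariant).

IsPartition : List ℕ → Set
IsPartition xs = All (0 <_) xs × Linked (λ a b → b ≤ a) xs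

Partition : Set
Partition = Σ (List ℕ) IsPartition

row : List ℕ → ℕ → ℕ
row []       _       = 0
row (x ∷ xs) zero    = x
row (x ∷ xs) (suc i) = row xs i

part : Partition → ℕ → ℕ
part la i = row (proj₁ la) i

size : Partition → ℕ
size la = sum (proj₁ la)

Box : Set
Box = ℕ × ℕ

BoxSet : Set₁
BoxSet = Box → Set

_∈D_ : Box → Partition → Set
(x , y) ∈D la = y < part la x

countCol : List ℕ → ℕ → ℕ → ℕ → ℕ
countCol xs c x zero    = 0
countCol xs c x (suc k) with c Data.Nat.<? row xs x
... | Relation.Nullary.yes _ = suc (countCol xs c (suc x) k)
... | Relation.Nullary.no  _ = countCol xs c (suc x) k

-- hook length of box (a , c): boxes (a , y) with c ≤ y in λ
-- (that is  λ_a ∸ c , including the box itself) plus boxes (x , c)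
-- of λ with x > a
hook : Partition → Box → ℕ
hook la (a , c) =
  (part la a ∸ c) + countCol (proj₁ la) c (suc a) (Data.List.length (proj₁ la))

IsJM : ℕ → Partition → Set
IsJM ℓ la = ¬ (Σ ℕ λ a → Σ ℕ λ b → Σ ℕ λ x → Σ ℕ λ y →
     ((a , b) ∈D la) × ((a , y) ∈D la) × ((x , b) ∈D la)
   × (ℓ ∣ hook la (a , b)) × ¬ (ℓ ∣ hook la (a , y)) × ¬ (ℓ ∣ hook la (x , b)))

Neighbour : Box → Box → Set
Neighbour (x , y) (x' , y') =
    (x ≡ x' × (suc y ≡ y' ⊎ suc y' ≡ y))
  ⊎ (y ≡ y' × (suc x ≡ x' ⊎ suc x' ≡ x))

Connected : BoxSet → Set
Connected S = ∀ p q → S p → S q →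
  Star (λ u v → S u × S v × Neighbour u v) p q

No2x2 : BoxSet → Set
No2x2 S = ¬ (Σ ℕ λ x → Σ ℕ λ y →
  S (x , y) × S (suc x , y) × S (x , suc y) × S (suc x , suc y))

_⊆D_ : Partition → Partition → Set
mu ⊆D la = ∀ i → part mu i ≤ part la i

skew : Partition → Partition → BoxSet
skew la mu b = (b ∈D la) × ¬ (b ∈D mu)

-- An ℓ-rim hook of λ is a set of boxes R ⊆ λ whose removal leaves the
-- Young diagram of a partition μ; we identify R with that μ, so
-- R = skew la mu.  Since μ ⊆ λ, the number of boxes of R is
-- size la ∸ size mu; we require size la ≡ size mu + ℓ.
IsRimHook : ℕ → Partition → Partition → Set
IsRimHook ℓ la mu =
  (mu ⊆D la) × (size la ≡ size mu + ℓ)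
  × Connected (skew la mu) × No2x2 (skew la mu)

Horizontal : BoxSet → Set
Horizontal S = Σ ℕ λ r → ∀ x y → S (x , y) → x ≡ r

Vertical : BoxSet → Set
Vertical S = Σ ℕ λ c → ∀ x y → S (x , y) → y ≡ c

Adjacent : BoxSet → BoxSet → Set
Adjacent R S = Σ Box λ p → Σ Box λ q → R p × S q × Neighbour p q

Cond1 : ℕ → Partition → Set
Cond1 ℓ la = ∀ mu → IsRimHook ℓ la mu →
  Horizontal (skew la mu) ⊎ Vertical (skew la mu)

Cond2 : ℕ → Partition → Set
Cond2 ℓ la = ∀ mu nu → IsRimHook ℓ la mu → IsRimHook ℓ mu nu →
  ((Vertical (skew la mu) × Horizontal (skew mu nu)) ⊎
   (Horizontal (skew la mu) × Vertical (skew mu nu))) →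
  ¬ Adjacent (skew la mu) (skew mu nu)

RemoveHV : ℕ → Partition → Partition → Set
RemoveHV ℓ la mu = IsRimHook ℓ la mu ×
  (Horizontal (skew la mu) ⊎ Vertical (skew la mu))

-- (3) is expressed by quantifying over all partitions reachable by
-- successive removals (including zero removals, which gives (1),(2))
IsGeneralized : ℕ → Partition → Set
IsGeneralized ℓ la = ∀ mu → Star (RemoveHV ℓ) la mu → Cond1 ℓ mu × Cond2 ℓ mu

{-# OPTIONS --safe #-}
module Submission where

-- On an abacus the rows of a partition are beads and its columns are gaps, a
-- box is a bead with a gap to its left, and its hook length is their distance.
-- Removing an ℓ-rim hook moves a bead by ℓ places to the left onto a gap, and
-- the hook is horizontal (vertical) when only gaps (beads) are passed.
--
-- The JM condition says that for a bead b and a gap g < b on the same runner,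
-- all gaps left of b or all beads right of g lie on that runner
-- (`Separated`).  A violation after a move comes from one before the move, so
-- the condition passes to all partitions obtained by removals, and there it
-- excludes crooked rim hooks and adjacent hooks of different directions.
--
-- Conversely, let a generalized ℓ-partition have a violation b, g, where by
-- induction on the size nothing obtained by a removal has one.  If b = g + ℓ,
-- only beads, say, lie between g and b; the gap of another runner left of g is
-- moved up to g until it sits on a crooked rim hook.  Otherwise, depending on
-- whether b − ℓ and g + ℓ are beads, some move keeps the violation alive, or
-- there is a violation with a smaller distance b − g, or b = g + 2ℓ and two
-- adjacent hooks of different directions can be removed.

open import Defs
open import Data.Bool using (Bool; true; false; T; _∧_; if_then_else_)
open import Data.Bool.ListAction using (any)
open import Data.Empty using (⊥; ⊥-elim)
open import Data.Fin using (Fin; zero; suc)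
open import Data.Integer as ℤ using (ℤ; -[1+_])
open import Data.List as List using (List; []; _∷_; length)
open import Data.List.Relation.Unary.All using (All; []; _∷_)
open import Data.List.Relation.Unary.Linked using (Linked; []; [-]; _∷_)
open import Data.Nat
open import Data.Nat.Divisibility
open import Data.Nat.ListAction using (sum)
open import Data.Nat.Properties
open import Data.Nat.Solver using (module +-*-Solver)
open import Data.Product using (_×_; _,_; proj₁; proj₂; ∃-syntax)
open import Data.Sum using (_⊎_; inj₁; inj₂)
open import Data.Unit using (⊤; tt)
open import Data.Vec using (Vec; []; _∷_; lookup)
open import Function using (_∘_)
open import Function.Bundles using (_⇔_; mk⇔)
open import Relation.Binary.Construct.Closure.ReflexiveTransitive
  using (Star; ε; _◅_; _◅◅_; reverse)
open import Relation.Binary.Definitions using (Tri; tri<; tri≈; tri>)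
open import Relation.Binary.PropositionalEquality
open import Relation.Nullary using (¬_; yes; no; Dec; contradiction)
open import Relation.Nullary.Decidable using (_×-dec_; _⊎-dec_; ¬?; decidable-stable)
open import Relation.Unary using (Decidable)

-- A reflective solver for linear arithmetic over ℕ.

module LinearArithmetic where

  open +-*-Solver using (solve) renaming (_:+_ to _⊹_; _:*_ to _⊛_; _:=_ to _⊜_)

  infixl 6 _:+_
  infix 4 _:≤_ _:<_ _:≡_
  infixr 3 _⇒_
  infix 3 ⊢_

  data Expr (n : ℕ) : Set where
    var  : Fin n → Expr n
    con  : ℕ → Expr n
    _:+_ : Expr n → Expr n → Expr n

  data Rel (n : ℕ) : Set where
    _:≤_ _:≡_ : Expr n → Expr n → Rel n

  _:<_ : ∀ {n} → Expr n → Expr n → Rel n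
  a :< b = con 1 :+ a :≤ b

  data Problem (n : ℕ) : Set where
    _⇒_ : Rel n → Problem n → Problem n
    ⊢_  : Rel n → Problem n
    ⊢⊥  : Problem n

  ⟦_⟧ᵉ : ∀ {n} → Expr n → Vec ℕ n → ℕ
  ⟦ var i ⟧ᵉ  ρ = lookup ρ i
  ⟦ con k ⟧ᵉ  ρ = k
  ⟦ a :+ b ⟧ᵉ ρ = ⟦ a ⟧ᵉ ρ + ⟦ b ⟧ᵉ ρ

  ⟦_⟧ʳ : ∀ {n} → Rel n → Vec ℕ n → Set
  ⟦ a :≤ b ⟧ʳ ρ = ⟦ a ⟧ᵉ ρ ≤ ⟦ b ⟧ᵉ ρ
  ⟦ a :≡ b ⟧ʳ ρ = ⟦ a ⟧ᵉ ρ ≡ ⟦ b ⟧ᵉ ρ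

  ⟦_⟧ : ∀ {n} → Problem n → Vec ℕ n → Set
  ⟦ h ⇒ p ⟧ ρ = ⟦ h ⟧ʳ ρ → ⟦ p ⟧ ρ
  ⟦ ⊢ g ⟧   ρ = ⟦ g ⟧ʳ ρ
  ⟦ ⊢⊥ ⟧    ρ = ⊥

  -- A linear form is its constant term followed by its coefficients.
  Form : ℕ → Set
  Form n = ℕ × Vec ℕ n

  dot : ∀ {n} → Vec ℕ n → Vec ℕ n → ℕ
  dot []       []       = 0
  dot (c ∷ cs) (x ∷ xs) = c * x + dot cs xs

  eval : ∀ {n} → Form n → Vec ℕ n → ℕ
  eval (k , cs) ρ = k + dot cs ρ

  _⊞ᵛ_ : ∀ {n} → Vec ℕ n → Vec ℕ n → Vec ℕ n
  []       ⊞ᵛ []       = []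
  (c ∷ cs) ⊞ᵛ (d ∷ ds) = c + d ∷ cs ⊞ᵛ ds

  _⊠ᵛ_ : ∀ {n} → ℕ → Vec ℕ n → Vec ℕ n
  m ⊠ᵛ []       = []
  m ⊠ᵛ (c ∷ cs) = m * c ∷ m ⊠ᵛ cs

  zeros : ∀ n → Vec ℕ n
  zeros zero    = []
  zeros (suc n) = 0 ∷ zeros n

  unit : ∀ {n} → Fin n → Vec ℕ n
  unit {suc n} zero    = 1 ∷ zeros n
  unit (suc i) = 0 ∷ unit i

  _⊞_ : ∀ {n} → Form n → Form n → Form n
  (k , cs) ⊞ (l , ds) = k + l , cs ⊞ᵛ ds

  _⊠_ : ∀ {n} → ℕ → Form n → Form n
  m ⊠ (k , cs) = m * k , m ⊠ᵛ cs

  dot-⊞ : ∀ {n} (cs ds ρ : Vec ℕ n) → dot (cs ⊞ᵛ ds) ρ ≡ dot cs ρ + dot ds ρ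
  dot-⊞ []       []       []      = refl
  dot-⊞ (c ∷ cs) (d ∷ ds) (x ∷ ρ) =
    trans (cong (_ +_) (dot-⊞ cs ds ρ)) (lemma c d x (dot cs ρ) (dot ds ρ))
    where
    lemma : ∀ c d x p q → (c + d) * x + (p + q) ≡ (c * x + p) + (d * x + q)
    lemma = solve 5 (λ c d x p q → (c ⊹ d) ⊛ x ⊹ (p ⊹ q) ⊜ (c ⊛ x ⊹ p) ⊹ (d ⊛ x ⊹ q)) refl

  dot-⊠ : ∀ {n} m (cs ρ : Vec ℕ n) → dot (m ⊠ᵛ cs) ρ ≡ m * dot cs ρ
  dot-⊠ m []       []      = sym (*-zeroʳ m)
  dot-⊠ m (c ∷ cs) (x ∷ ρ) =
    trans (cong (_ +_) (dot-⊠ m cs ρ)) (lemma m c x (dot cs ρ))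
    where
    lemma : ∀ m c x p → m * c * x + m * p ≡ m * (c * x + p)
    lemma = solve 4 (λ m c x p → m ⊛ c ⊛ x ⊹ m ⊛ p ⊜ m ⊛ (c ⊛ x ⊹ p)) refl

  dot-zeros : ∀ {n} (ρ : Vec ℕ n) → dot (zeros n) ρ ≡ 0
  dot-zeros []      = refl
  dot-zeros (x ∷ ρ) = dot-zeros ρ

  dot-unit : ∀ {n} (i : Fin n) (ρ : Vec ℕ n) → dot (unit i) ρ ≡ lookup ρ i
  dot-unit zero    (x ∷ ρ) =
    trans (cong (1 * x +_) (dot-zeros ρ)) (trans (+-identityʳ _) (*-identityˡ x))
  dot-unit (suc i) (x ∷ ρ) = dot-unit i ρ

  eval-⊞ : ∀ {n} (f g : Form n) ρ → eval (f ⊞ g) ρ ≡ eval f ρ + eval g ρ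
  eval-⊞ (k , cs) (l , ds) ρ =
    trans (cong (k + l +_) (dot-⊞ cs ds ρ)) (lemma k l (dot cs ρ) (dot ds ρ))
    where
    lemma : ∀ k l p q → k + l + (p + q) ≡ (k + p) + (l + q)
    lemma = solve 4 (λ k l p q → k ⊹ l ⊹ (p ⊹ q) ⊜ (k ⊹ p) ⊹ (l ⊹ q)) refl

  eval-⊠ : ∀ {n} m (f : Form n) ρ → eval (m ⊠ f) ρ ≡ m * eval f ρ
  eval-⊠ m (k , cs) ρ =
    trans (cong (m * k +_) (dot-⊠ m cs ρ)) (sym (*-distribˡ-+ m k (dot cs ρ)))

  linearize : ∀ {n} → Expr n → Form n
  linearize (var i)  = 0 , unit i
  linearize (con k)  = k , zeros _
  linearize (a :+ b) = linearize a ⊞ linearize b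

  linearize-sound : ∀ {n} (e : Expr n) ρ → eval (linearize e) ρ ≡ ⟦ e ⟧ᵉ ρ
  linearize-sound (var i)  ρ = dot-unit i ρ
  linearize-sound (con k)  ρ = trans (cong (k +_) (dot-zeros ρ)) (+-identityʳ k)
  linearize-sound (a :+ b) ρ =
    trans (eval-⊞ (linearize a) (linearize b) ρ)
          (cong₂ _+_ (linearize-sound a ρ) (linearize-sound b ρ))

  dominates : ∀ {n} → Vec ℕ n → Vec ℕ n → Bool
  dominates []       []       = true
  dominates (c ∷ cs) (d ∷ ds) = (d ≤ᵇ c) ∧ dominates cs ds

  T-∧ : ∀ a {b} → T (a ∧ b) → T a × T b
  T-∧ true t = tt , t

  dominates-sound : ∀ {n} (cs ds ρ : Vec ℕ n) → T (dominates cs ds) → dot ds ρ ≤ dot cs ρ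
  dominates-sound []       []       []      _ = ≤-refl
  dominates-sound (c ∷ cs) (d ∷ ds) (x ∷ ρ) t with T-∧ (d ≤ᵇ c) t
  ... | t₁ , t₂ = +-mono-≤ (*-monoˡ-≤ x (≤ᵇ⇒≤ d c t₁)) (dominates-sound cs ds ρ t₂)

  -- A certificate assigns a multiplier to every hypothesis; only equations may
  -- get a negative one.
  add : ∀ {n} → ℕ → Expr n → Expr n → Form n × Form n → Form n × Form n
  add m a b (A , B) = ((m ⊠ linearize a) ⊞ A) , ((m ⊠ linearize b) ⊞ B)

  combine : ∀ {n} → List (Rel n) → List ℤ → Form n × Form n
  combine []              _               = (0 , zeros _) , (0 , zeros _)
  combine (_ ∷ _)         []              = (0 , zeros _) , (0 , zeros _)
  combine ((a :≤ b) ∷ hs) (ℤ.+ m ∷ ms)    = add m a b (combine hs ms)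
  combine ((a :≤ b) ∷ hs) (-[1+ m ] ∷ ms) = combine hs ms
  combine ((a :≡ b) ∷ hs) (ℤ.+ m ∷ ms)    = add m a b (combine hs ms)
  combine ((a :≡ b) ∷ hs) (-[1+ m ] ∷ ms) = add (suc m) b a (combine hs ms)

  Holds : ∀ {n} → List (Rel n) → Vec ℕ n → Set
  Holds []       ρ = ⊤
  Holds (h ∷ hs) ρ = ⟦ h ⟧ʳ ρ × Holds hs ρ

  _⊑_at_ : ∀ {n} → Form n → Form n → Vec ℕ n → Set
  A ⊑ B at ρ = eval A ρ ≤ eval B ρ

  add-sound : ∀ {n} m (a b : Expr n) (AB : Form n × Form n) ρ →
              ⟦ a ⟧ᵉ ρ ≤ ⟦ b ⟧ᵉ ρ → proj₁ AB ⊑ proj₂ AB at ρ →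
              proj₁ (add m a b AB) ⊑ proj₂ (add m a b AB) at ρ
  add-sound m a b (A , B) ρ a≤b A≤B = begin
    eval ((m ⊠ linearize a) ⊞ A) ρ  ≡⟨ expand a A ⟩
    m * ⟦ a ⟧ᵉ ρ + eval A ρ         ≤⟨ +-mono-≤ (*-monoʳ-≤ m a≤b) A≤B ⟩
    m * ⟦ b ⟧ᵉ ρ + eval B ρ         ≡⟨ sym (expand b B) ⟩
    eval ((m ⊠ linearize b) ⊞ B) ρ  ∎
    where
    open ≤-Reasoning
    expand : ∀ e F → eval ((m ⊠ linearize e) ⊞ F) ρ ≡ m * ⟦ e ⟧ᵉ ρ + eval F ρ
    expand e F =
      trans (eval-⊞ (m ⊠ linearize e) F ρ)
            (cong (_+ eval F ρ)
                  (trans (eval-⊠ m (linearize e) ρ) (cong (m *_) (linearize-sound e ρ))))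

  combine-sound : ∀ {n} (hs : List (Rel n)) ms ρ → Holds hs ρ →
                  proj₁ (combine hs ms) ⊑ proj₂ (combine hs ms) at ρ
  combine-sound []              _               ρ _        = ≤-refl
  combine-sound (_ ∷ _)         []              ρ _        = ≤-refl
  combine-sound ((a :≤ b) ∷ hs) (ℤ.+ m ∷ ms)    ρ (h , H) =
    add-sound m a b (combine hs ms) ρ h (combine-sound hs ms ρ H)
  combine-sound ((a :≤ b) ∷ hs) (-[1+ m ] ∷ ms) ρ (h , H) = combine-sound hs ms ρ H
  combine-sound ((a :≡ b) ∷ hs) (ℤ.+ m ∷ ms)    ρ (h , H) =
    add-sound m a b (combine hs ms) ρ (≤-reflexive h) (combine-sound hs ms ρ H)
  combine-sound ((a :≡ b) ∷ hs) (-[1+ m ] ∷ ms) ρ (h , H) =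
    add-sound (suc m) b a (combine hs ms) ρ (≤-reflexive (sym h)) (combine-sound hs ms ρ H)

  -- A sufficient test for `A ≤ B` to fail at every point: the variables are natural numbers, so
  -- larger coefficients in `A` cannot make up for its larger constant.
  exceeds : ∀ {n} → Form n × Form n → Bool
  exceeds ((k , cs) , (l , ds)) = (suc l ≤ᵇ k) ∧ dominates cs ds

  exceeds-sound : ∀ {n} (AB : Form n × Form n) ρ → T (exceeds AB) →
                  ¬ proj₁ AB ⊑ proj₂ AB at ρ
  exceeds-sound ((k , cs) , (l , ds)) ρ t with T-∧ (suc l ≤ᵇ k) t
  ... | t₁ , t₂ = <⇒≱ (+-mono-<-≤ (≤ᵇ⇒≤ (suc l) k t₁) (dominates-sound cs ds ρ t₂))

  refutes : ∀ {n} → List (Rel n) → List ℤ → Bool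
  refutes hs ms = exceeds (combine hs ms)

  refutes-sound : ∀ {n} (hs : List (Rel n)) ms ρ → T (refutes hs ms) → ¬ Holds hs ρ
  refutes-sound hs ms ρ t H = exceeds-sound (combine hs ms) ρ t (combine-sound hs ms ρ H)

  -- The certificate is found by Gaussian elimination on the equations followed
  -- by Fourier–Motzkin elimination over ℚ.  Nothing has to be proved about the
  -- search, since `refutes` checks its outcome.  The forms of the rows carry
  -- their constant term last and stand for a value ≥ 0.
  record Row : Set where
    constructor _by_
    field
      form : List ℤ
      mult : List ℤ
  open Row

  _⊕_ : List ℤ → List ℤ → List ℤ
  (x ∷ xs) ⊕ (y ∷ ys) = (x ℤ.+ y) ∷ (xs ⊕ ys)
  _        ⊕ _        = []

  scale : ℤ → List ℤ → List ℤ
  scale m = List.map (m ℤ.*_)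

  mix : ℤ → Row → ℤ → Row → Row
  mix m r n s = (scale m (form r) ⊕ scale n (form s)) by (scale m (mult r) ⊕ scale n (mult s))

  coeff : ℕ → List ℤ → ℤ
  coeff _       []       = ℤ.+ 0
  coeff zero    (x ∷ xs) = x
  coeff (suc i) (x ∷ xs) = coeff i xs

  isZero isPos isNeg : ℤ → Bool
  isZero (ℤ.+ zero)   = true
  isZero _          = false
  isPos (ℤ.+ (suc _)) = true
  isPos _           = false
  isNeg -[1+ _ ]    = true
  isNeg _           = false

  pivot : ℕ → ℕ → List ℤ → List ℕ
  pivot _ _       []       = []
  pivot i zero    _        = []
  pivot i (suc n) (x ∷ xs) = if isZero x then pivot (suc i) n xs else i ∷ []

  -- The row is multiplied by the absolute value of the pivot, so that an inequality keeps its
  -- direction; only the equation takes a signed factor.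
  cancel : ℕ → Row → Row → Row
  cancel i e r with coeff i (form e)
  ... | ℤ.+ k      = mix (ℤ.+ k) r (ℤ.- coeff i (form r)) e
  ... | -[1+ k ] = mix (ℤ.+ suc k) r (coeff i (form r)) e

  gauss : ℕ → ℕ → List Row → List Row → List Row
  gauss zero       n _        rs = rs
  gauss (suc fuel) n []       rs = rs
  gauss (suc fuel) n (e ∷ es) rs with pivot 0 n (form e)
  ... | i ∷ _ = gauss fuel n (List.map (cancel i e) es) (List.map (cancel i e) rs)
  -- No variable is left in the equation. Kept with both signs, it exposes a nonzero constant of
  -- either sign.
  ... | []    = gauss fuel n es (e ∷ mix (ℤ.+ 0) e (ℤ.- (ℤ.+ 1)) e ∷ rs)

  pairs : ℕ → List Row → List Row → List Row
  pairs i ps ns = List.concatMap (λ p → List.map (eliminate p) ns) ps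
    where
    eliminate : Row → Row → Row
    eliminate p q = mix (ℤ.+ ℤ.∣ coeff i (form q) ∣) p (ℤ.+ ℤ.∣ coeff i (form p) ∣) q

  -- A row without a negative entry already follows from the nonnegativity of the variables;
  -- dropping it limits the growth of the elimination.
  useful : Row → Bool
  useful r = any isNeg (form r)

  fourierMotzkin : ℕ → ℕ → List Row → List Row
  fourierMotzkin i zero    rs = rs
  fourierMotzkin i (suc n) rs =
    fourierMotzkin (suc i) n
      (List.filterᵇ (λ r → isZero (coeff i (form r))) rs List.++
       List.filterᵇ useful
         (pairs i (List.filterᵇ (λ r → isPos (coeff i (form r))) rs)
                  (List.filterᵇ (λ r → isNeg (coeff i (form r))) rs)))

  toList : ∀ {n} → Vec ℕ n → List ℕ
  toList []       = []
  toList (c ∷ cs) = c ∷ toList cs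

  subtract : ∀ {n} → Form n → Form n → List ℤ
  subtract (l , ds) (k , cs) = List.zipWith ℤ._⊖_ (toList ds) (toList cs) List.++ (l ℤ.⊖ k) ∷ []

  difference : ∀ {n} → Expr n → Expr n → List ℤ
  difference a b = subtract (linearize b) (linearize a)

  kronecker : ℕ → ℕ → List ℤ
  kronecker zero    _       = []
  kronecker (suc n) zero    = ℤ.+ 1 ∷ kronecker n n
  kronecker (suc n) (suc i) = ℤ.+ 0 ∷ kronecker n i

  equations inequations : ∀ {n} → ℕ → ℕ → List (Rel n) → List Row
  equations m i []              = []
  equations m i ((a :≡ b) ∷ hs) = (difference a b by kronecker m i) ∷ equations m (suc i) hs
  equations m i ((a :≤ b) ∷ hs) = equations m (suc i) hs
  inequations m i []              = []
  inequations m i ((a :≤ b) ∷ hs) = (difference a b by kronecker m i) ∷ inequations m (suc i) hs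
  inequations m i ((a :≡ b) ∷ hs) = inequations m (suc i) hs

  -- The multipliers `kronecker m m` are all zero: these rows are no hypotheses of the problem, and
  -- the check accounts for them through `dominates`.
  nonnegative : ℕ → ℕ → ℕ → List Row
  nonnegative m n zero    = []
  nonnegative m n (suc i) = (kronecker (suc n) i by kronecker m m) ∷ nonnegative m n i

  certificate : ∀ {n} → List (Rel n) → List ℤ
  certificate {n} hs =
    let m  = List.length hs
        es = equations m 0 hs
        rs = fourierMotzkin 0 n
               (gauss m n es (inequations m 0 hs List.++ nonnegative m n n))
    -- Entry `n` is the constant term. The first row claiming that a negative constant is ≥ 0 is
    -- taken; if there is none, the empty certificate makes `refutes` fail.
    in List.foldr (λ r _ → mult r) [] (List.filterᵇ (λ r → isNeg (coeff n (form r))) rs)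

  refutable : ∀ {n} → List (Rel n) → Bool
  refutable hs = refutes hs (certificate hs)

  refutable-sound : ∀ {n} (hs : List (Rel n)) ρ → T (refutable hs) → ¬ Holds hs ρ
  refutable-sound hs = refutes-sound hs (certificate hs)

  valid : ∀ {n} → List (Rel n) → Problem n → Bool
  valid hs (h ⇒ p)      = valid (h ∷ hs) p
  valid hs (⊢ (a :≤ b)) = refutable ((b :< a) ∷ hs)
  valid hs (⊢ (a :≡ b)) = refutable ((b :< a) ∷ hs) ∧ refutable ((a :< b) ∷ hs)
  valid hs ⊢⊥           = refutable hs

  valid-sound : ∀ {n} (hs : List (Rel n)) p ρ → T (valid hs p) → Holds hs ρ → ⟦ p ⟧ ρ
  valid-sound hs (h ⇒ p)      ρ t H = λ x → valid-sound (h ∷ hs) p ρ t (x , H)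
  valid-sound hs (⊢ (a :≤ b)) ρ t H =
    ≮⇒≥ λ b<a → refutable-sound ((b :< a) ∷ hs) ρ t (b<a , H)
  valid-sound hs (⊢ (a :≡ b)) ρ t H with T-∧ (refutable ((b :< a) ∷ hs)) t
  ... | t₁ , t₂ =
    ≤-antisym (≮⇒≥ λ b<a → refutable-sound ((b :< a) ∷ hs) ρ t₁ (b<a , H))
              (≮⇒≥ λ a<b → refutable-sound ((a :< b) ∷ hs) ρ t₂ (a<b , H))
  valid-sound hs ⊢⊥           ρ t H = ⊥-elim (refutable-sound hs ρ t H)

  Π : ∀ n → (Vec ℕ n → Set) → Set
  Π zero    P = P []
  Π (suc n) P = ∀ x → Π n (λ ρ → P (x ∷ ρ))

  Λ : ∀ n {P : Vec ℕ n → Set} → (∀ ρ → P ρ) → Π n P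
  Λ zero    f = f []
  Λ (suc n) f = λ x → Λ n (λ ρ → f (x ∷ ρ))

  Nary : ℕ → Set → Set → Set
  Nary zero    A B = B
  Nary (suc n) A B = A → Nary n A B

  apply : ∀ {A B : Set} n → Nary n A B → (Fin n → A) → B
  apply zero    f xs = f
  apply (suc n) f xs = apply n (f (xs zero)) (λ i → xs (suc i))

  -- Abstract, because `with` would otherwise unfold the certificates.
  abstract
    lia : ∀ n (f : Nary n (Expr n) (Problem n)) →
          {T (valid [] (apply n f var))} → Π n ⟦ apply n f var ⟧
    lia n f {t} = Λ n (λ ρ → valid-sound [] (apply n f var) ρ t tt)

open LinearArithmetic using (lia; con; _:+_; _:≤_; _:<_; _:≡_; _⇒_; ⊢_; ⊢⊥)

-- Abaci

between : ℕ → ℕ → (ℕ → Set) → Set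
between a b P = ∀ p → a < p → p < b → P p

between? : ∀ {P} → Decidable P → ∀ a b → between a b P ⊎ ∃[ p ] a < p × p < b × ¬ P p
between? {P} P? a b with anyUpTo? (λ p → (a <? p) ×-dec ¬? (P? p)) b
... | yes (p , p<b , a<p , ¬Pp) = inj₂ (p , a<p , p<b , ¬Pp)
... | no none = inj₁ λ p a<p p<b → decide p a<p p<b (P? p)
  where
  decide : ∀ p → a < p → p < b → Dec (P p) → P p
  decide p a<p p<b (yes Pp) = Pp
  decide p a<p p<b (no ¬Pp) = contradiction (p , p<b , a<p , ¬Pp) none

predecessor : ∀ {n} → 0 < n → ∃[ m ] suc m ≡ n
predecessor {suc n} _ = n , refl

module Abacus (ℓ : ℕ) (2<ℓ : 2 < ℓ) where

  ∤-small : ∀ {d} → 0 < d → d < ℓ → ¬ ℓ ∣ d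
  ∤-small {suc d} _ d<ℓ = >⇒∤ d<ℓ

  ∤1 : ¬ ℓ ∣ 1
  ∤1 = ∤-small (s≤s z≤n) (<-trans (s≤s (s≤s z≤n)) 2<ℓ)

  ∤⇒>0 : ∀ {d} → ¬ ℓ ∣ d → 0 < d
  ∤⇒>0 {zero}  ℓ∤d = contradiction (ℓ ∣0) ℓ∤d
  ∤⇒>0 {suc d} ℓ∤d = s≤s z≤n

  ∤-+ : ∀ {d e} → ℓ ∣ e → ¬ ℓ ∣ d → ¬ ℓ ∣ e + d
  ∤-+ ℓ∣e ℓ∤d ℓ∣e+d = ℓ∤d (∣m+n∣m⇒∣n ℓ∣e+d ℓ∣e)

  ∤-∸ : ∀ {d e} → ℓ ∣ e → ¬ ℓ ∣ e + d → ¬ ℓ ∣ d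
  ∤-∸ ℓ∣e ℓ∤e+d ℓ∣d = ℓ∤e+d (∣m∣n⇒∣m+n ℓ∣e ℓ∣d)

  ∤-pred : ∀ {d e} → ℓ ∣ e → suc d ≡ e → ¬ ℓ ∣ d
  ∤-pred ℓ∣e refl ℓ∣d = ∤1 (∣m+n∣m⇒∣n (subst (ℓ ∣_) (+-comm 1 _) ℓ∣e) ℓ∣d)

  -- The bead `b` and the gap `g` stand for the box whose hook length `D` is divisible by ℓ, the gap
  -- `g′` for another column in its row, the bead `b′` for another row in its column. Distances
  -- enter through equations, so that no truncated subtraction occurs.
  Separated : (ℕ → Set) → Set
  Separated B = ∀ {b g g′ b′ D d′ d″} → B b → ¬ B g → ¬ B g′ → B b′ →
    g + D ≡ b → g′ + d′ ≡ b → g + d″ ≡ b′ → ℓ ∣ D → ¬ ℓ ∣ d′ → ¬ ℓ ∣ d″ → ⊥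

  Moved : (ℕ → Set) → ℕ → ℕ → ℕ → Set
  Moved B x g p = p ≡ g ⊎ (B p × p ≢ x)

  Straight : (ℕ → Set) → Set
  Straight B = ∀ {g x} → g + ℓ ≡ x → B x → ¬ B g →
    between g x B ⊎ between g x (λ p → ¬ B p)

  -- One instance of condition (2): whether `m` is a bead or a gap, the moves from `m` to `g` and
  -- from `b` to `m`, in the order that is possible, remove a vertical and a horizontal hook that
  -- touch.
  NoCorner : (ℕ → Set) → Set
  NoCorner B = ∀ {g m b} → g + ℓ ≡ m → m + ℓ ≡ b → ¬ B g → B b →
    between g m B → between m b (λ p → ¬ B p) → ⊥

  module _ {B : ℕ → Set} (B? : Decidable B) where

    Moved? : ∀ x g → Decidable (Moved B x g)
    Moved? x g p = (p ≟ g) ⊎-dec (B? p ×-dec ¬? (p ≟ x))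

    -- A gap `p` and a bead `q` strictly between `g` and `x` lie at distances between 0 and ℓ from
    -- `x` and `g`, hence violate separation at `x`, `g`.
    separated⇒straight : Separated B → Straight B
    separated⇒straight sep {g} {x} g+ℓ≡x Bx ¬Bg with between? B? g x
    ... | inj₁ beads = inj₁ beads
    ... | inj₂ (p , g<p , p<x , ¬Bp) = inj₂ λ q g<q q<x Bq →
      sep Bx ¬Bg ¬Bp Bq g+ℓ≡x (m+[n∸m]≡n (<⇒≤ p<x)) (m+[n∸m]≡n (<⇒≤ g<q)) ∣-refl
        (∤-small (m<n⇒0<n∸m p<x)
          (lia 5 (λ p e x g ℓ → p :+ e :≡ x ⇒ g :< p ⇒ g :+ ℓ :≡ x ⇒ ⊢ e :< ℓ)
             p (x ∸ p) x g ℓ (m+[n∸m]≡n (<⇒≤ p<x)) g<p g+ℓ≡x))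
        (∤-small (m<n⇒0<n∸m g<q)
          (lia 5 (λ g e q x ℓ → g :+ e :≡ q ⇒ q :< x ⇒ g :+ ℓ :≡ x ⇒ ⊢ e :< ℓ)
             g (q ∸ g) q x ℓ (m+[n∸m]≡n (<⇒≤ g<q)) q<x g+ℓ≡x))

    -- A bead or gap of the new configuration is replaced by a bead further
    -- right, or a gap further left, of the old one on the same runner.
    separated-moved : ∀ {x g} → g + ℓ ≡ x → B x → ¬ B g →
                      Separated B → Separated (Moved B x g)
    separated-moved {x} {g} g+ℓ≡x Bx ¬Bg sep
        {b₀} {g₀} {g₀′} {b₀′} {D} {d′} {d″} Mb Mg Mg′ Mb′ eqD eq′ eq″ ℓ∣D ℓ∤d′ ℓ∤d″
      with bead Mb | gap Mg | gap Mg′ | bead Mb′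
      where
      bead : ∀ {p} → Moved B x g p → ∃[ q ] ∃[ e ] p + e ≡ q × ℓ ∣ e × B q
      bead (inj₁ refl)     = x , ℓ , g+ℓ≡x , ∣-refl , Bx
      bead (inj₂ (Bp , _)) = _ , 0 , +-identityʳ _ , ℓ ∣0 , Bp
      gap : ∀ {p} → ¬ Moved B x g p → ∃[ q ] ∃[ e ] q + e ≡ p × ℓ ∣ e × ¬ B q
      gap {p} ¬M with p ≟ x
      ... | yes refl = g , ℓ , g+ℓ≡x , ∣-refl , ¬Bg
      ... | no p≢x   = p , 0 , +-identityʳ _ , ℓ ∣0 , λ Bp → ¬M (inj₂ (Bp , p≢x))
    ... | b₁ , e₁ , q₁ , ℓ∣e₁ , Bb₁ | g₂ , e₂ , q₂ , ℓ∣e₂ , ¬Bg₂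
        | g₃ , e₃ , q₃ , ℓ∣e₃ , ¬Bg₃ | b₄ , e₄ , q₄ , ℓ∣e₄ , Bb₄ =
      sep Bb₁ ¬Bg₂ ¬Bg₃ Bb₄
        (chain g₂ e₁ e₂ D q₁ q₂ eqD) (chain g₃ e₁ e₃ d′ q₁ q₃ eq′) (chain g₂ e₄ e₂ d″ q₄ q₂ eq″)
        (∣m∣n⇒∣m+n (∣m∣n⇒∣m+n ℓ∣e₁ ℓ∣e₂) ℓ∣D)
        (∤-+ (∣m∣n⇒∣m+n ℓ∣e₁ ℓ∣e₃) ℓ∤d′) (∤-+ (∣m∣n⇒∣m+n ℓ∣e₄ ℓ∣e₂) ℓ∤d″)
      where
      chain : ∀ {b′ b g} g′ e f d → b + e ≡ b′ → g′ + f ≡ g → g + d ≡ b → g′ + (e + f + d) ≡ b′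
      chain {b′} {b} {g} =
        λ g′ e f d → lia 7 (λ b′ b g g′ e f d → b :+ e :≡ b′ ⇒ g′ :+ f :≡ g ⇒ g :+ d :≡ b ⇒
          ⊢ g′ :+ (e :+ f :+ d) :≡ b′) b′ b g g′ e f d

  -- Separation of a configuration from straightness and separation after every move.

  module _ {B : ℕ → Set} (B? : Decidable B) (straight : Straight B) (noCorner : NoCorner B)
           (moved-separated : ∀ {g x} → g + ℓ ≡ x → B x → ¬ B g → Separated (Moved B x g))
           where

    private
      ℓ-1 : ℕ
      ℓ-1 = pred ℓ

      ℓ-1+1≡ℓ : suc ℓ-1 ≡ ℓ
      ℓ-1+1≡ℓ = suc-pred ℓ {{>-nonZero (<-trans (s≤s z≤n) 2<ℓ)}}

    private
      moved-bead : ∀ {x g p} → B p → p ≢ x → Moved B x g p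
      moved-bead Bp p≢x = inj₂ (Bp , p≢x)

      moved-gap : ∀ {x g p} → ¬ B p → p ≢ g → ¬ Moved B x g p
      moved-gap ¬Bp p≢g (inj₁ p≡g)      = p≢g p≡g
      moved-gap ¬Bp p≢g (inj₂ (Bp , _)) = ¬Bp Bp

      moved-source : ∀ {x g} → g + ℓ ≡ x → ¬ Moved B x g x
      moved-source {x} {g} g+ℓ≡x (inj₁ x≡g) =
        lia 3 (λ g x ℓ → g :+ ℓ :≡ x ⇒ x :≡ g ⇒ con 2 :< ℓ ⇒ ⊢⊥) g x ℓ g+ℓ≡x x≡g 2<ℓ
      moved-source g+ℓ≡x (inj₂ (_ , x≢x)) = x≢x refl

    -- The gap h lies left of g, at distance e; it is moved right towards g.
    no-gap-left : ∀ n {g x h e} → e ≤ n → g + ℓ ≡ x → B x → ¬ B g → between g x B →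
                  h + e ≡ g → ¬ ℓ ∣ e → ¬ B h → ⊥
    no-gap-left zero {e = e} e≤n _ _ _ _ _ ℓ∤e _ = <⇒≱ (∤⇒>0 ℓ∤e) e≤n
    no-gap-left (suc n) {g} {x} {h} {e} e≤n g+ℓ≡x Bx ¬Bg beads h+e≡g ℓ∤e ¬Bh
      with <-cmp ℓ e
    ... | tri≈ _ refl _ = ℓ∤e ∣-refl
    ... | tri< ℓ<e _ _ with B? (h + ℓ)
    ...   | no ¬Bc =
      no-gap-left n (lia 4 (λ e n e₂ ℓ → e :≤ con 1 :+ n ⇒ ℓ :+ e₂ :≡ e ⇒ con 2 :< ℓ ⇒ ⊢ e₂ :≤ n)
                       e n (e ∸ ℓ) ℓ e≤n (m+[n∸m]≡n (<⇒≤ ℓ<e)) 2<ℓ)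
        g+ℓ≡x Bx ¬Bg beads
        (lia 5 (λ h ℓ e e₂ g → h :+ e :≡ g ⇒ ℓ :+ e₂ :≡ e ⇒ ⊢ h :+ ℓ :+ e₂ :≡ g)
           h ℓ e (e ∸ ℓ) g h+e≡g (m+[n∸m]≡n (<⇒≤ ℓ<e)))
        (∤-∸ ∣-refl (subst (λ d → ¬ ℓ ∣ d) (sym (m+[n∸m]≡n (<⇒≤ ℓ<e))) ℓ∤e))
        ¬Bc
    -- After the move of `h + ℓ` to `h`, the place `h + ℓ` is a gap on another runner left of `x`,
    -- and `suc g` is still a bead: a violation at `x`, `g`.
    ...   | yes Bc =
      moved-separated refl Bc ¬Bh
        (moved-bead Bx λ x≡c →
          lia 5 (λ h e g ℓ x → h :+ e :≡ g ⇒ g :+ ℓ :≡ x ⇒ ℓ :< e ⇒ x :≡ h :+ ℓ ⇒ ⊢⊥)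
            h e g ℓ x h+e≡g g+ℓ≡x ℓ<e x≡c)
        (moved-gap ¬Bg λ g≡h →
          lia 4 (λ h e g ℓ → h :+ e :≡ g ⇒ ℓ :< e ⇒ g :≡ h ⇒ ⊢⊥) h e g ℓ h+e≡g ℓ<e g≡h)
        (moved-source refl)
        (moved-bead (beads (suc g) ≤-refl
            (lia 3 (λ g ℓ x → g :+ ℓ :≡ x ⇒ con 2 :< ℓ ⇒ ⊢ con 1 :+ g :< x) g ℓ x g+ℓ≡x 2<ℓ))
          λ g+1≡c →
          lia 4 (λ h e g ℓ → h :+ e :≡ g ⇒ ℓ :< e ⇒ con 1 :+ g :≡ h :+ ℓ ⇒ ⊢⊥)
            h e g ℓ h+e≡g ℓ<e g+1≡c)
        g+ℓ≡x
        (lia 5 (λ h e g ℓ x → h :+ e :≡ g ⇒ g :+ ℓ :≡ x ⇒ ⊢ h :+ ℓ :+ e :≡ x)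
           h e g ℓ x h+e≡g g+ℓ≡x)
        (+-comm g 1) ∣-refl ℓ∤e ∤1
    no-gap-left (suc n) {g} {x} {h} {e} e≤n g+ℓ≡x Bx ¬Bg beads h+e≡g ℓ∤e ¬Bh
        | tri> _ _ e<ℓ with straight refl Bc ¬Bh
      where
      Bc : B (h + ℓ)
      Bc = beads (h + ℓ)
        (lia 4 (λ h e g ℓ → h :+ e :≡ g ⇒ e :< ℓ ⇒ ⊢ g :< h :+ ℓ) h e g ℓ h+e≡g e<ℓ)
        (lia 5 (λ h e g ℓ x → h :+ e :≡ g ⇒ g :+ ℓ :≡ x ⇒ con 0 :< e ⇒ ⊢ h :+ ℓ :< x)
           h e g ℓ x h+e≡g g+ℓ≡x (∤⇒>0 ℓ∤e))
    ... | inj₁ all-beads = ¬Bg (all-beads g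
      (lia 3 (λ h e g → h :+ e :≡ g ⇒ con 0 :< e ⇒ ⊢ h :< g) h e g h+e≡g (∤⇒>0 ℓ∤e))
      (lia 4 (λ h e g ℓ → h :+ e :≡ g ⇒ e :< ℓ ⇒ ⊢ g :< h :+ ℓ) h e g ℓ h+e≡g e<ℓ))
    ... | inj₂ all-gaps with suc g <? h + ℓ
    ...   | yes g+1<c = all-gaps (suc g)
      (lia 3 (λ h e g → h :+ e :≡ g ⇒ ⊢ h :< con 1 :+ g) h e g h+e≡g) g+1<c
      (beads (suc g) ≤-refl
        (lia 5 (λ h e g ℓ x → h :+ e :≡ g ⇒ con 1 :+ g :< h :+ ℓ ⇒ g :+ ℓ :≡ x ⇒ ⊢ con 1 :+ g :< x)
           h e g ℓ x h+e≡g g+1<c g+ℓ≡x))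
    -- Here `h + ℓ` is `suc g`. For p = g - 1 the hook from `p + ℓ` to `p` passes the gap `g` and
    -- the bead `suc g`; ℓ > 2 puts `p` right of `h`, among the gaps.
    ...   | no g+1≮c
      with predecessor {g} (lia 3 (λ h e g → h :+ e :≡ g ⇒ con 0 :< e ⇒ ⊢ con 0 :< g)
                              h e g h+e≡g (∤⇒>0 ℓ∤e))
    ...     | p , p+1≡g with straight {p} refl
      (beads (p + ℓ)
        (lia 3 (λ p g ℓ → con 1 :+ p :≡ g ⇒ con 2 :< ℓ ⇒ ⊢ g :< p :+ ℓ) p g ℓ p+1≡g 2<ℓ)
        (lia 4 (λ p g ℓ x → con 1 :+ p :≡ g ⇒ g :+ ℓ :≡ x ⇒ ⊢ p :+ ℓ :< x) p g ℓ x p+1≡g g+ℓ≡x))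
      (all-gaps p
        (lia 4 (λ h g p ℓ → con 1 :+ p :≡ g ⇒ h :+ ℓ :≤ con 1 :+ g ⇒ con 2 :< ℓ ⇒ ⊢ h :< p)
           h g p ℓ p+1≡g (≮⇒≥ g+1≮c) 2<ℓ)
        (lia 5 (λ h e g p ℓ → con 1 :+ p :≡ g ⇒ h :+ e :≡ g ⇒ e :< ℓ ⇒ ⊢ p :< h :+ ℓ)
           h e g p ℓ p+1≡g h+e≡g e<ℓ))
    ...       | inj₁ beads′ = ¬Bg (beads′ g (≤-reflexive p+1≡g)
      (lia 3 (λ p g ℓ → con 1 :+ p :≡ g ⇒ con 2 :< ℓ ⇒ ⊢ g :< p :+ ℓ) p g ℓ p+1≡g 2<ℓ))
    ...       | inj₂ gaps′ = gaps′ (suc g)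
      (lia 2 (λ p g → con 1 :+ p :≡ g ⇒ ⊢ p :< con 1 :+ g) p g p+1≡g)
      (lia 3 (λ p g ℓ → con 1 :+ p :≡ g ⇒ con 2 :< ℓ ⇒ ⊢ con 1 :+ g :< p :+ ℓ) p g ℓ p+1≡g 2<ℓ)
      (beads (suc g) ≤-refl
        (lia 3 (λ g ℓ x → g :+ ℓ :≡ x ⇒ con 2 :< ℓ ⇒ ⊢ con 1 :+ g :< x) g ℓ x g+ℓ≡x 2<ℓ))

    -- Mirror image of `no-gap-left`, since reversing the abacus exchanges beads and gaps: the bead
    -- `b` is replaced by beads nearer to `x`, ℓ places at a time.
    no-bead-right : ∀ n {g x b e} → e ≤ n → g + ℓ ≡ x → B x → ¬ B g →
                    between g x (λ p → ¬ B p) → x + e ≡ b → ¬ ℓ ∣ e → B b → ⊥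
    no-bead-right zero {e = e} e≤n _ _ _ _ _ ℓ∤e _ = <⇒≱ (∤⇒>0 ℓ∤e) e≤n
    no-bead-right (suc n) {g} {x} {b} {e} e≤n g+ℓ≡x Bx ¬Bg gaps x+e≡b ℓ∤e Bb
      with <-cmp ℓ e
    ... | tri≈ _ refl _ = ℓ∤e ∣-refl
    ... | tri< ℓ<e _ _ with B? (x + (e ∸ ℓ))
    ...   | yes Bc =
      no-bead-right n (lia 4 (λ e n e₂ ℓ → e :≤ con 1 :+ n ⇒ ℓ :+ e₂ :≡ e ⇒ con 2 :< ℓ ⇒ ⊢ e₂ :≤ n)
                         e n (e ∸ ℓ) ℓ e≤n (m+[n∸m]≡n (<⇒≤ ℓ<e)) 2<ℓ)
        g+ℓ≡x Bx ¬Bg gaps refl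
        (∤-∸ ∣-refl (subst (λ d → ¬ ℓ ∣ d) (sym (m+[n∸m]≡n (<⇒≤ ℓ<e))) ℓ∤e))
        Bc
    ...   | no ¬Bc =
      moved-separated
        (lia 5 (λ x ℓ e e₂ b → x :+ e :≡ b ⇒ ℓ :+ e₂ :≡ e ⇒ ⊢ x :+ e₂ :+ ℓ :≡ b)
           x ℓ e (e ∸ ℓ) b x+e≡b (m+[n∸m]≡n (<⇒≤ ℓ<e)))
        Bb ¬Bc
        (moved-bead Bx λ x≡b →
          lia 4 (λ x e b ℓ → x :+ e :≡ b ⇒ ℓ :< e ⇒ x :≡ b ⇒ ⊢⊥) x e b ℓ x+e≡b ℓ<e x≡b)
        (moved-gap ¬Bg λ g≡c →
          lia 4 (λ x ℓ g e₂ → g :+ ℓ :≡ x ⇒ con 2 :< ℓ ⇒ g :≡ x :+ e₂ ⇒ ⊢⊥)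
            x ℓ g (e ∸ ℓ) g+ℓ≡x 2<ℓ g≡c)
        (moved-gap (gaps (suc g) ≤-refl
            (lia 3 (λ g ℓ x → g :+ ℓ :≡ x ⇒ con 2 :< ℓ ⇒ ⊢ con 1 :+ g :< x) g ℓ x g+ℓ≡x 2<ℓ))
          λ g+1≡c →
          lia 4 (λ g ℓ x e₂ → g :+ ℓ :≡ x ⇒ con 2 :< ℓ ⇒ con 1 :+ g :≡ x :+ e₂ ⇒ ⊢⊥)
            g ℓ x (e ∸ ℓ) g+ℓ≡x 2<ℓ g+1≡c)
        (inj₁ refl)
        g+ℓ≡x
        (lia 4 (λ g ℓ x k → g :+ ℓ :≡ x ⇒ con 1 :+ k :≡ ℓ ⇒ ⊢ con 1 :+ g :+ k :≡ x)
           g ℓ x ℓ-1 g+ℓ≡x ℓ-1+1≡ℓ)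
        (lia 5 (λ g ℓ x e e₂ → g :+ ℓ :≡ x ⇒ ℓ :+ e₂ :≡ e ⇒ ⊢ g :+ e :≡ x :+ e₂)
           g ℓ x e (e ∸ ℓ) g+ℓ≡x (m+[n∸m]≡n (<⇒≤ ℓ<e)))
        ∣-refl (∤-pred ∣-refl ℓ-1+1≡ℓ) ℓ∤e
    no-bead-right (suc n) {g} {x} {b} {e} e≤n g+ℓ≡x Bx ¬Bg gaps x+e≡b ℓ∤e Bb
        | tri> _ _ e<ℓ with straight {g + e} g+e+ℓ≡b Bb ¬Bc
      where
      g+e+ℓ≡b : g + e + ℓ ≡ b
      g+e+ℓ≡b = lia 5 (λ g e x ℓ b → g :+ ℓ :≡ x ⇒ x :+ e :≡ b ⇒ ⊢ g :+ e :+ ℓ :≡ b)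
                  g e x ℓ b g+ℓ≡x x+e≡b
      ¬Bc : ¬ B (g + e)
      ¬Bc = gaps (g + e)
        (lia 2 (λ g e → con 0 :< e ⇒ ⊢ g :< g :+ e) g e (∤⇒>0 ℓ∤e))
        (lia 4 (λ g e x ℓ → g :+ ℓ :≡ x ⇒ e :< ℓ ⇒ ⊢ g :+ e :< x) g e x ℓ g+ℓ≡x e<ℓ)
    ... | inj₂ all-gaps = all-gaps x
      (lia 4 (λ g e x ℓ → g :+ ℓ :≡ x ⇒ e :< ℓ ⇒ ⊢ g :+ e :< x) g e x ℓ g+ℓ≡x e<ℓ)
      (lia 3 (λ x e b → x :+ e :≡ b ⇒ con 0 :< e ⇒ ⊢ x :< b) x e b x+e≡b (∤⇒>0 ℓ∤e)) Bx
    ... | inj₁ all-beads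
      with predecessor {x} (lia 3 (λ g x ℓ → g :+ ℓ :≡ x ⇒ con 2 :< ℓ ⇒ ⊢ con 0 :< x)
                              g x ℓ g+ℓ≡x 2<ℓ)
    ...   | p , p+1≡x with g + e <? p
    ...     | yes c<p =
      gaps p (lia 3 (λ g e p → g :+ e :< p ⇒ ⊢ g :< p) g e p c<p) (≤-reflexive p+1≡x)
        (all-beads p c<p
          (lia 4 (λ p x e b → con 1 :+ p :≡ x ⇒ x :+ e :≡ b ⇒ ⊢ p :< b) p x e b p+1≡x x+e≡b))
    -- Now `g + e` is x - 1. The hook from `suc x` to `suc g` passes the gap x - 1 and the bead `x`;
    -- ℓ > 2 puts `suc x` left of `b`, among the beads.
    ...     | no c≮p with straight {suc g} {suc x} (cong suc g+ℓ≡x)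
      (all-beads (suc x)
        (lia 4 (λ g e x ℓ → g :+ ℓ :≡ x ⇒ e :< ℓ ⇒ ⊢ g :+ e :< con 1 :+ x) g e x ℓ g+ℓ≡x e<ℓ)
        (lia 6 (λ g e x ℓ b p → g :+ ℓ :≡ x ⇒ x :+ e :≡ b ⇒ con 1 :+ p :≡ x ⇒ p :≤ g :+ e ⇒
          con 2 :< ℓ ⇒ ⊢ con 1 :+ x :< b) g e x ℓ b p g+ℓ≡x x+e≡b p+1≡x (≮⇒≥ c≮p) 2<ℓ))
      (gaps (suc g) ≤-refl
        (lia 3 (λ g ℓ x → g :+ ℓ :≡ x ⇒ con 2 :< ℓ ⇒ ⊢ con 1 :+ g :< x) g ℓ x g+ℓ≡x 2<ℓ))
    ...       | inj₂ gaps′ = gaps′ x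
      (lia 3 (λ g ℓ x → g :+ ℓ :≡ x ⇒ con 2 :< ℓ ⇒ ⊢ con 1 :+ g :< x) g ℓ x g+ℓ≡x 2<ℓ)
      ≤-refl Bx
    ...       | inj₁ beads′ =
      gaps p (lia 4 (λ g ℓ x p → g :+ ℓ :≡ x ⇒ con 2 :< ℓ ⇒ con 1 :+ p :≡ x ⇒ ⊢ g :< p)
                g ℓ x p g+ℓ≡x 2<ℓ p+1≡x)
        (≤-reflexive p+1≡x)
        (beads′ p
          (lia 4 (λ g ℓ x p → g :+ ℓ :≡ x ⇒ con 2 :< ℓ ⇒ con 1 :+ p :≡ x ⇒ ⊢ con 1 :+ g :< p)
             g ℓ x p g+ℓ≡x 2<ℓ p+1≡x)
          (lia 2 (λ x p → con 1 :+ p :≡ x ⇒ ⊢ p :< con 1 :+ x) x p p+1≡x))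

    -- If only beads lie between `g` and `b`, then `g′` must lie left of `g`; if only gaps, then
    -- `b′` must lie right of `b`. The two preceding lemmas exclude these.
    no-short : ∀ {b g g′ b′ d′ d″} → B b → ¬ B g → ¬ B g′ → B b′ →
      g + ℓ ≡ b → g′ + d′ ≡ b → g + d″ ≡ b′ → ¬ ℓ ∣ d′ → ¬ ℓ ∣ d″ → ⊥
    no-short {b} {g} {g′} {b′} {d′} {d″} Bb ¬Bg ¬Bg′ Bb′ g+ℓ≡b eq′ eq″ ℓ∤d′ ℓ∤d″
      with straight g+ℓ≡b Bb ¬Bg
    ... | inj₁ beads with <-cmp ℓ d′
    ...   | tri≈ _ refl _ = ℓ∤d′ ∣-refl
    ...   | tri> _ _ d′<ℓ = ¬Bg′ (beads g′
      (lia 5 (λ g ℓ b g′ d′ → g :+ ℓ :≡ b ⇒ g′ :+ d′ :≡ b ⇒ d′ :< ℓ ⇒ ⊢ g :< g′) g ℓ b g′ d′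
         g+ℓ≡b eq′ d′<ℓ)
      (lia 3 (λ b g′ d′ → g′ :+ d′ :≡ b ⇒ con 0 :< d′ ⇒ ⊢ g′ :< b) b g′ d′ eq′ (∤⇒>0 ℓ∤d′)))
    ...   | tri< ℓ<d′ _ _ = no-gap-left (d′ ∸ ℓ) ≤-refl g+ℓ≡b Bb ¬Bg beads
      (lia 6 (λ g ℓ b g′ d′ e → g :+ ℓ :≡ b ⇒ g′ :+ d′ :≡ b ⇒ ℓ :+ e :≡ d′ ⇒ ⊢ g′ :+ e :≡ g)
         g ℓ b g′ d′ (d′ ∸ ℓ) g+ℓ≡b eq′ (m+[n∸m]≡n (<⇒≤ ℓ<d′)))
      (∤-∸ ∣-refl (subst (λ d → ¬ ℓ ∣ d) (sym (m+[n∸m]≡n (<⇒≤ ℓ<d′))) ℓ∤d′)) ¬Bg′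
    no-short {b} {g} {g′} {b′} {d′} {d″} Bb ¬Bg ¬Bg′ Bb′ g+ℓ≡b eq′ eq″ ℓ∤d′ ℓ∤d″
        | inj₂ gaps with <-cmp ℓ d″
    ...   | tri≈ _ refl _ = ℓ∤d″ ∣-refl
    ...   | tri> _ _ d″<ℓ = gaps b′
      (lia 3 (λ g b′ d″ → g :+ d″ :≡ b′ ⇒ con 0 :< d″ ⇒ ⊢ g :< b′) g b′ d″ eq″ (∤⇒>0 ℓ∤d″))
      (lia 5 (λ g ℓ b b′ d″ → g :+ ℓ :≡ b ⇒ g :+ d″ :≡ b′ ⇒ d″ :< ℓ ⇒ ⊢ b′ :< b) g ℓ b b′ d″
         g+ℓ≡b eq″ d″<ℓ) Bb′
    ...   | tri< ℓ<d″ _ _ = no-bead-right (d″ ∸ ℓ) ≤-refl g+ℓ≡b Bb ¬Bg gaps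
      (lia 6 (λ g ℓ b b′ d″ e → g :+ ℓ :≡ b ⇒ g :+ d″ :≡ b′ ⇒ ℓ :+ e :≡ d″ ⇒ ⊢ b :+ e :≡ b′)
         g ℓ b b′ d″ (d″ ∸ ℓ) g+ℓ≡b eq″ (m+[n∸m]≡n (<⇒≤ ℓ<d″)))
      (∤-∸ ∣-refl (subst (λ d → ¬ ℓ ∣ d) (sym (m+[n∸m]≡n (<⇒≤ ℓ<d″))) ℓ∤d″)) Bb′

    private
      -- A violation at distance 2ℓ + E, while none exists at distance ℓ + E. The positions `x` and
      -- `y`, one ℓ right of `g` and one ℓ left of `b`, coincide when E = 0.
      module Long {E b g g′ b′ d′ d″} (ℓ∣E : ℓ ∣ E)
        (shorter : ∀ {b g g′ b′ d′ d″} → B b → ¬ B g → ¬ B g′ → B b′ →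
           g + (ℓ + E) ≡ b → g′ + d′ ≡ b → g + d″ ≡ b′ → ¬ ℓ ∣ d′ → ¬ ℓ ∣ d″ → ⊥)
        (Bb : B b) (¬Bg : ¬ B g) (¬Bg′ : ¬ B g′) (Bb′ : B b′)
        (eqD : g + (ℓ + (ℓ + E)) ≡ b) (eq′ : g′ + d′ ≡ b) (eq″ : g + d″ ≡ b′)
        (ℓ∤d′ : ¬ ℓ ∣ d′) (ℓ∤d″ : ¬ ℓ ∣ d″) where

        x y : ℕ
        x = g + ℓ
        y = g + ℓ + E

        y+ℓ≡b : y + ℓ ≡ b
        y+ℓ≡b = lia 4 (λ g ℓ E b → g :+ (ℓ :+ (ℓ :+ E)) :≡ b ⇒ ⊢ g :+ ℓ :+ E :+ ℓ :≡ b)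
                  g ℓ E b eqD

        ℓ∣D : ℓ ∣ ℓ + E
        ℓ∣D = ∣m∣n⇒∣m+n ∣-refl ℓ∣E

        x+D≡b : x + (ℓ + E) ≡ b
        x+D≡b = trans (+-assoc g ℓ (ℓ + E)) eqD

        g+D≡y : g + (ℓ + E) ≡ y
        g+D≡y = sym (+-assoc g ℓ E)

        b′≢b : b′ ≢ b
        b′≢b b′≡b = ℓ∤d″ (subst (ℓ ∣_)
          (lia 5 (λ g ℓ E b d → g :+ (ℓ :+ (ℓ :+ E)) :≡ b ⇒ g :+ d :≡ b ⇒ ⊢ ℓ :+ (ℓ :+ E) :≡ d)
             g ℓ E b d″ eqD (trans eq″ b′≡b))
          (∣m∣n⇒∣m+n ∣-refl ℓ∣D))

        g′≢g : g′ ≢ g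
        g′≢g g′≡g = ℓ∤d′ (subst (ℓ ∣_)
          (lia 6 (λ g g′ ℓ E b d → g :+ (ℓ :+ (ℓ :+ E)) :≡ b ⇒ g′ :+ d :≡ b ⇒ g′ :≡ g ⇒
             ⊢ ℓ :+ (ℓ :+ E) :≡ d) g g′ ℓ E b d′ eqD eq′ g′≡g)
          (∣m∣n⇒∣m+n ∣-refl ℓ∣D))

        b≢x : b ≢ x
        b≢x b≡x = lia 4 (λ g ℓ E b → g :+ (ℓ :+ (ℓ :+ E)) :≡ b ⇒ con 2 :< ℓ ⇒ b :≡ g :+ ℓ ⇒ ⊢⊥)
                    g ℓ E b eqD 2<ℓ b≡x

        g≢y : g ≢ y
        g≢y g≡y = lia 3 (λ g ℓ E → con 2 :< ℓ ⇒ g :≡ g :+ ℓ :+ E ⇒ ⊢⊥) g ℓ E 2<ℓ g≡y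

        -- If `y` is a bead, then `y`, `g` is a pair at the smaller distance, and a gap left of `y`
        -- on another runner would together with `b′` contradict `shorter`. The next two lemmas
        -- treat the pairs `x`, `g` and `b`, `x` alike.
        beads-left-of-y : B y → ∀ {p f} → p + f ≡ y → ¬ ℓ ∣ f → B p
        beads-left-of-y By {p} p+f≡y ℓ∤f =
          decidable-stable (B? p) λ ¬Bp → shorter By ¬Bg ¬Bp Bb′ g+D≡y p+f≡y eq″ ℓ∤f ℓ∤d″

        beads-left-of-x : B x → ∀ {p f} → p + f ≡ x → ¬ ℓ ∣ f → B p
        beads-left-of-x Bx {p} p+f≡x ℓ∤f =
          decidable-stable (B? p) λ ¬Bp → no-short Bx ¬Bg ¬Bp Bb′ refl p+f≡x eq″ ℓ∤f ℓ∤d″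

        gaps-right-of-x : ¬ B x → ∀ {p f} → x + f ≡ p → ¬ ℓ ∣ f → ¬ B p
        gaps-right-of-x ¬Bx x+f≡p ℓ∤f Bp = shorter Bb ¬Bx ¬Bg′ Bp x+D≡b eq′ x+f≡p ℓ∤d′ ℓ∤f

        x+1 : x + 1 ≡ suc x
        x+1 = +-comm x 1


        x+ℓ≡b : E ≡ 0 → x + ℓ ≡ b
        x+ℓ≡b E≡0 =
          lia 4 (λ g ℓ E b → g :+ (ℓ :+ (ℓ :+ E)) :≡ b ⇒ E :≡ con 0 ⇒ ⊢ g :+ ℓ :+ ℓ :≡ b)
            g ℓ E b eqD E≡0

        -- If E = 0, moving the bead x to g makes all of (x , b) gaps.
        no-bead-at-x : E ≡ 0 → ¬ B x
        no-bead-at-x E≡0 Bx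
          with separated⇒straight (Moved? B? x g) (moved-separated refl Bx ¬Bg) (x+ℓ≡b E≡0)
                 (moved-bead Bb b≢x) (moved-source refl)
        ... | inj₁ beads with <-cmp ℓ d′
        ...   | tri≈ _ refl _ = ℓ∤d′ ∣-refl
        ...   | tri< ℓ<d′ _ _ = ¬Bg′ (beads-left-of-x Bx
          (lia 7 (λ g ℓ E b g′ d e → g :+ (ℓ :+ (ℓ :+ E)) :≡ b ⇒ E :≡ con 0 ⇒ g′ :+ d :≡ b ⇒
             ℓ :+ e :≡ d ⇒ ⊢ g′ :+ e :≡ g :+ ℓ)
             g ℓ E b g′ d′ (d′ ∸ ℓ) eqD E≡0 eq′ (m+[n∸m]≡n (<⇒≤ ℓ<d′)))
          (∤-∸ ∣-refl (subst (λ d → ¬ ℓ ∣ d) (sym (m+[n∸m]≡n (<⇒≤ ℓ<d′))) ℓ∤d′)))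
        ...   | tri> _ _ d′<ℓ = moved-gap ¬Bg′ g′≢g (beads g′
          (lia 5 (λ g ℓ b g′ d → g :+ ℓ :+ ℓ :≡ b ⇒ g′ :+ d :≡ b ⇒ d :< ℓ ⇒ ⊢ g :+ ℓ :< g′)
             g ℓ b g′ d′ (x+ℓ≡b E≡0) eq′ d′<ℓ)
          (lia 3 (λ b g′ d → g′ :+ d :≡ b ⇒ con 0 :< d ⇒ ⊢ g′ :< b) b g′ d′ eq′ (∤⇒>0 ℓ∤d′)))
        no-bead-at-x E≡0 Bx | inj₂ gaps = noCorner refl (x+ℓ≡b E≡0) ¬Bg Bb
          (λ p g<p p<x → beads-left-of-x Bx (m+[n∸m]≡n (<⇒≤ p<x))
            (∤-small (m<n⇒0<n∸m p<x)
              (lia 4 (λ g p e ℓ → g :< p ⇒ p :+ e :≡ g :+ ℓ ⇒ ⊢ e :< ℓ) g p (x ∸ p) ℓ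
                 g<p (m+[n∸m]≡n (<⇒≤ p<x)))))
          (λ p x<p p<b Bp → gaps p x<p p<b (moved-bead Bp (>⇒≢ x<p)))

        -- Dually, `b` moves to `x`. Only gaps between `g` and `x` would leave no place for `b′`,
        -- and only beads there, with the gaps between `x` and `b`, form the corner that `noCorner`
        -- excludes.
        no-gap-at-x : E ≡ 0 → ¬ ¬ B x
        no-gap-at-x E≡0 ¬Bx
          with separated⇒straight (Moved? B? b x) (moved-separated (x+ℓ≡b E≡0) Bb ¬Bx) refl
                 (inj₁ refl) (moved-gap ¬Bg λ g≡x → m+1+n≢m g (trans (cong (g +_) ℓ-1+1≡ℓ) (sym g≡x)))
        ... | inj₁ beads = noCorner refl (x+ℓ≡b E≡0) ¬Bg Bb
          (λ p g<p p<x → old-bead p<x (beads p g<p p<x))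
          (λ p x<p p<b → gaps-right-of-x ¬Bx (m+[n∸m]≡n (<⇒≤ x<p))
            (∤-small (m<n⇒0<n∸m x<p)
              (lia 5 (λ x p e b ℓ → p :< b ⇒ x :+ e :≡ p ⇒ x :+ ℓ :≡ b ⇒ ⊢ e :< ℓ) x p (p ∸ x) b ℓ
                 p<b (m+[n∸m]≡n (<⇒≤ x<p)) (x+ℓ≡b E≡0))))
          where
          old-bead : ∀ {p} → p < x → Moved B b x p → B p
          old-bead p<x (inj₁ p≡x)      = contradiction p≡x (<⇒≢ p<x)
          old-bead p<x (inj₂ (Bp , _)) = Bp
        ... | inj₂ gaps with <-cmp ℓ d″
        ...   | tri≈ _ refl _ = ℓ∤d″ ∣-refl
        ...   | tri< ℓ<d″ _ _ = gaps-right-of-x ¬Bx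
          (lia 5 (λ g ℓ b′ d e → g :+ d :≡ b′ ⇒ ℓ :+ e :≡ d ⇒ ⊢ g :+ ℓ :+ e :≡ b′)
             g ℓ b′ d″ (d″ ∸ ℓ) eq″ (m+[n∸m]≡n (<⇒≤ ℓ<d″)))
          (∤-∸ ∣-refl (subst (λ d → ¬ ℓ ∣ d) (sym (m+[n∸m]≡n (<⇒≤ ℓ<d″))) ℓ∤d″)) Bb′
        ...   | tri> _ _ d″<ℓ = gaps b′
          (lia 3 (λ g b′ d → g :+ d :≡ b′ ⇒ con 0 :< d ⇒ ⊢ g :< b′) g b′ d″ eq″ (∤⇒>0 ℓ∤d″))
          (lia 4 (λ g ℓ b′ d → g :+ d :≡ b′ ⇒ d :< ℓ ⇒ ⊢ b′ :< g :+ ℓ) g ℓ b′ d″ eq″ d″<ℓ)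
          (moved-bead Bb′ b′≢b)

        module _ {e} (e+1≡E : suc e ≡ E) where

          ℓ∤e : ¬ ℓ ∣ e
          ℓ∤e = ∤-pred ℓ∣E e+1≡E

          x+1+e≡y : suc x + e ≡ y
          x+1+e≡y = lia 3 (λ x e E → con 1 :+ e :≡ E ⇒ ⊢ con 1 :+ x :+ e :≡ x :+ E) x e E e+1≡E

          -- After the move of `x` to `g`, the pair `b`, `x` would be violated by `g′` and the bead
          -- `suc x`.
          bead-at-x⇒gap-at-x+1 : B x → ¬ B (suc x)
          bead-at-x⇒gap-at-x+1 Bx Bx+1 =
            moved-separated refl Bx ¬Bg (moved-bead Bb b≢x) (moved-source refl)
              (moved-gap ¬Bg′ g′≢g) (moved-bead Bx+1 1+n≢n)
              x+D≡b eq′ x+1 ℓ∣D ℓ∤d′ ∤1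

          -- After the move of `b` to `y`, the pair `y`, `g` would be violated by a gap at `p` and
          -- the bead `b″`.
          gap-at-y⇒bead-before : ¬ B y → ∀ {p f b″ f′} → p + f ≡ y → ¬ ℓ ∣ f → B b″ → b″ ≢ b →
                                 g + f′ ≡ b″ → ¬ ℓ ∣ f′ → B p
          gap-at-y⇒bead-before ¬By {p} {f} p+f≡y ℓ∤f Bb″ b″≢b eqf′ ℓ∤f′ =
            decidable-stable (B? p) λ ¬Bp →
              moved-separated y+ℓ≡b Bb ¬By (inj₁ refl) (moved-gap ¬Bg g≢y)
                (moved-gap ¬Bp λ p≡y → ℓ∤f (subst (ℓ ∣_) (sym (f≡0 p≡y)) (ℓ ∣0)))
                (moved-bead Bb″ b″≢b) g+D≡y p+f≡y eqf′ ℓ∣D ℓ∤f ℓ∤f′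
            where
            f≡0 : p ≡ y → f ≡ 0
            f≡0 p≡y = lia 3 (λ p f y → p :+ f :≡ y ⇒ p :≡ y ⇒ ⊢ f :≡ con 0) p f y p+f≡y p≡y

          -- In each case one position is forced to be both a bead and a gap: y - 1 when `x` and `y`
          -- are gaps, `suc x` otherwise.
          apart : ⊥
          apart with B? x | B? y
          ... | yes Bx | yes By = bead-at-x⇒gap-at-x+1 Bx (beads-left-of-y By x+1+e≡y ℓ∤e)
          ... | no ¬Bx | yes By = gaps-right-of-x ¬Bx x+1 ∤1 (beads-left-of-y By x+1+e≡y ℓ∤e)
          ... | no ¬Bx | no ¬By =
            gaps-right-of-x ¬Bx refl ℓ∤e
              (gap-at-y⇒bead-before ¬By (trans (+-comm (x + e) 1) x+1+e≡y) ∤1 Bb′ b′≢b eq″ ℓ∤d″)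
          -- The role of `b″` falls to `suc g`, a bead because it lies ℓ - 1 places left of the bead
          -- `x`.
          ... | yes Bx | no ¬By =
            bead-at-x⇒gap-at-x+1 Bx
              (gap-at-y⇒bead-before ¬By x+1+e≡y ℓ∤e
                (beads-left-of-x Bx
                  (lia 3 (λ g ℓ k → con 1 :+ k :≡ ℓ ⇒ ⊢ con 1 :+ g :+ k :≡ g :+ ℓ)
                     g ℓ ℓ-1 ℓ-1+1≡ℓ)
                  (∤-pred ∣-refl ℓ-1+1≡ℓ))
                (λ g+1≡b → lia 4 (λ g ℓ E b → g :+ (ℓ :+ (ℓ :+ E)) :≡ b ⇒ con 2 :< ℓ ⇒
                             con 1 :+ g :≡ b ⇒ ⊢⊥) g ℓ E b eqD 2<ℓ g+1≡b)
                (+-comm g 1) ∤1)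

        impossible : ⊥
        impossible with E ≟ 0
        ... | yes E≡0 = no-gap-at-x E≡0 (no-bead-at-x E≡0)
        ... | no E≢0 with predecessor (n≢0⇒n>0 E≢0)
        ...   | e , e+1≡E = apart e+1≡E

    -- Induction on the multiple of ℓ. For E = k * ℓ the distance unfolds definitionally to ℓ + (ℓ +
    -- E), as `Long` expects.
    no-long : ∀ k {b g g′ b′ d′ d″} → B b → ¬ B g → ¬ B g′ → B b′ →
      g + suc k * ℓ ≡ b → g′ + d′ ≡ b → g + d″ ≡ b′ → ¬ ℓ ∣ d′ → ¬ ℓ ∣ d″ → ⊥
    no-long zero Bb ¬Bg ¬Bg′ Bb′ eqD =
      no-short Bb ¬Bg ¬Bg′ Bb′ (trans (cong (_ +_) (sym (+-identityʳ ℓ))) eqD)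
    no-long (suc k) Bb ¬Bg ¬Bg′ Bb′ eqD eq′ eq″ ℓ∤d′ ℓ∤d″ =
      Long.impossible (n∣m*n k) (no-long k) Bb ¬Bg ¬Bg′ Bb′ eqD eq′ eq″ ℓ∤d′ ℓ∤d″

    straight⇒separated : Separated B
    straight⇒separated Bb ¬Bg ¬Bg′ Bb′ eqD eq′ eq″ (divides zero refl) ℓ∤d′ ℓ∤d″ =
      ¬Bg (subst B (trans (sym eqD) (+-identityʳ _)) Bb)
    straight⇒separated Bb ¬Bg ¬Bg′ Bb′ eqD eq′ eq″ (divides (suc k) refl) ℓ∤d′ ℓ∤d″ =
      no-long k Bb ¬Bg ¬Bg′ Bb′ eqD eq′ eq″ ℓ∤d′ ℓ∤d″

-- Beads, gaps and hook lengths

least : ∀ {P : ℕ → Set} → Decidable P → ∀ n → P n →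
        ∃[ m ] m ≤ n × P m × (∀ {k} → k < m → ¬ P k)
least P? zero P0 = 0 , z≤n , P0 , λ ()
least {P} P? (suc n) Pn with P? 0
... | yes P0 = 0 , z≤n , P0 , λ ()
... | no ¬P0 with least (λ k → P? (suc k)) n Pn
...   | m , m≤n , Pm , below = suc m , s≤s m≤n , Pm , earlier
  where
  earlier : ∀ {k} → k < suc m → ¬ P k
  earlier {zero}  _         = ¬P0
  earlier {suc k} (s≤s k<m) = below k<m

row-step : ∀ {xs} → Linked (λ a b → b ≤ a) xs → ∀ i → row xs (suc i) ≤ row xs i
row-step []        i       = z≤n
row-step [-]       i       = z≤n
row-step (x≥y ∷ l) zero    = x≥y
row-step (x≥y ∷ l) (suc i) = row-step l i

part-anti : ∀ la {i j} → i ≤ j → part la j ≤ part la i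
part-anti la {i} {j} i≤j = go (≤⇒≤′ i≤j)
  where
  go : ∀ {j} → i ≤′ j → part la j ≤ part la i
  go ≤′-refl                = ≤-refl
  go (≤′-step {n = j} i≤′j) = ≤-trans (row-step (proj₂ (proj₂ la)) j) (go i≤′j)

-- The number of beads is a parameter bounded below by the number of rows, so that a partition and
-- everything obtained from it by removals share one abacus.
Fits : ℕ → Partition → Set
Fits N la = ∀ {i} → N ≤ i → part la i ≡ 0

row-beyond : ∀ xs {i} → length xs ≤ i → row xs i ≡ 0
row-beyond []       _         = refl
row-beyond (x ∷ xs) (s≤s l≤i) = row-beyond xs l≤i

fits-length : ∀ la → Fits (length (proj₁ la)) la
fits-length la = row-beyond (proj₁ la)

fits-⊆ : ∀ {N la mu} → mu ⊆D la → Fits N la → Fits N mu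
fits-⊆ {la = la} {mu} mu⊆la fits {i} N≤i =
  n≤0⇒n≡0 (≤-trans (mu⊆la i) (≤-reflexive (fits N≤i)))

nonempty-row<N : ∀ {N la} → Fits N la → ∀ {i} → 0 < part la i → i < N
nonempty-row<N fits 0<la = ≰⇒> λ N≤i → <⇒≱ 0<la (≤-reflexive (fits N≤i))

IsColumn : Partition → ℕ → ℕ → Set
IsColumn la c r = (∀ {i} → i < r → c < part la i) × part la r ≤ c

column : ∀ {N la} → Fits N la → ∀ c → ∃[ r ] r ≤ N × IsColumn la c r
column {N} {la} fits c with least (λ r → part la r ≤? c) N (≤-trans (≤-reflexive (fits ≤-refl)) z≤n)
... | r , r≤N , la≤c , earlier = r , r≤N , (λ i<r → ≰⇒> (earlier i<r)) , la≤c

row-in-column : ∀ {la a c r} → IsColumn la c r → c < part la a → a < r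
row-in-column {la} (_ , la≤c) c<la = ≰⇒> λ r≤a → <⇒≱ c<la (≤-trans (part-anti la r≤a) la≤c)

-- The i-th bead of la on the abacus with N beads is at part la i + N ∸ suc i;
-- the gap of column c, of height r, is at c + N ∸ r.
Bead : ℕ → Partition → ℕ → Set
Bead N la p = ∃[ i ] i < N × p + suc i ≡ part la i + N

Bead? : ∀ N la → Decidable (Bead N la)
Bead? N la p = anyUpTo? (λ i → p + suc i ≟ part la i + N) N

GapOf : ℕ → Partition → ℕ → Set
GapOf N la p = ∃[ c ] ∃[ r ] r ≤ N × IsColumn la c r × p + r ≡ c + N

-- The beads of the rows that meet column `c` lie right of its gap, those of the other rows left of
-- it.
gap⇒¬bead : ∀ {N la p} → GapOf N la p → ¬ Bead N la p
gap⇒¬bead {N} {la} {p} (c , r , r≤N , (tall , la≤c) , gap) (i , i<N , bead) with i <? r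
... | yes i<r = lia 6 (λ N l p c r i → p :+ r :≡ c :+ N ⇒ p :+ (con 1 :+ i) :≡ l :+ N ⇒ i :< r ⇒
                  c :< l ⇒ ⊢⊥) N (part la i) p c r i gap bead i<r (tall i<r)
... | no i≮r = lia 6 (λ N l p c r i → p :+ r :≡ c :+ N ⇒ p :+ (con 1 :+ i) :≡ l :+ N ⇒ r :≤ i ⇒
                  l :≤ c ⇒ ⊢⊥) N (part la i) p c r i gap bead (≮⇒≥ i≮r)
                  (≤-trans (part-anti la (≮⇒≥ i≮r)) la≤c)

-- The height `r` is the first row whose bead would lie left of `p`, and `p + r ≡ c + N` then
-- dictates the column. As `p` is no bead, the preceding row has its bead strictly right of `p`,
-- hence reaches past `c`.
¬bead⇒gap : ∀ {N la p} → Fits N la → ¬ Bead N la p → GapOf N la p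
¬bead⇒gap {N} {la} {p} fits ¬bead
  with least (λ r → part la r + N ≤? p + r) N
         (≤-trans (+-monoˡ-≤ N (≤-reflexive (fits ≤-refl))) (m≤n+m N p))
... | r , r≤N , la+N≤p+r , earlier =
  p + r ∸ N , r , r≤N , (tall r≤N earlier c+N , low) , sym c+N
  where
  c+N : p + r ∸ N + N ≡ p + r
  c+N = m∸n+n≡m (≤-trans (m≤n+m N _) la+N≤p+r)
  low : part la r ≤ p + r ∸ N
  low = lia 5 (λ l N p r c → l :+ N :≤ p :+ r ⇒ c :+ N :≡ p :+ r ⇒ ⊢ l :≤ c)
          (part la r) N p r (p + r ∸ N) la+N≤p+r c+N
  tall : ∀ {r c} → r ≤ N → (∀ {k} → k < r → ¬ part la k + N ≤ p + k) → c + N ≡ p + r →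
         ∀ {i} → i < r → c < part la i
  tall {suc r} {c} r<N earlier c+N {i} (s≤s i≤r) with <-cmp (p + suc r) (part la r + N)
  ... | tri≈ _ eq _ = contradiction (r , r<N , eq) ¬bead
  ... | tri< lt _ _ = <-≤-trans
    (lia 5 (λ l N p r c → p :+ (con 1 :+ r) :< l :+ N ⇒ c :+ N :≡ p :+ (con 1 :+ r) ⇒ ⊢ c :< l)
       (part la r) N p r c lt c+N)
    (part-anti la i≤r)
  ... | tri> _ _ gt =
    contradiction (s≤s⁻¹ (≤-trans gt (≤-reflexive (+-suc p r)))) (earlier ≤-refl)

countCol-column : ∀ {la c r} → IsColumn la c r → ∀ x k → r ≤ x + k →
                  countCol (proj₁ la) c x k ≡ r ∸ x
countCol-column col x zero r≤x+k =
  sym (m≤n⇒m∸n≡0 (≤-trans r≤x+k (≤-reflexive (+-identityʳ x))))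
countCol-column {la} {c} {r} col x (suc k) r≤x+k with c Data.Nat.<? row (proj₁ la) x
... | yes c<la = trans
  (cong suc (countCol-column {la} col (suc x) k (≤-trans r≤x+k (≤-reflexive (+-suc x k)))))
  (sym (+-∸-assoc 1 (row-in-column {la} col c<la)))
... | no c≮la = trans
  (countCol-column {la} col (suc x) k (≤-trans r≤x+k (≤-reflexive (+-suc x k))))
  (trans (m≤n⇒m∸n≡0 (≤-trans r≤x (n≤1+n x))) (sym (m≤n⇒m∸n≡0 r≤x)))
  where
  r≤x : r ≤ x
  r≤x = ≮⇒≥ λ x<r → c≮la (proj₁ col x<r)

column-height≤length : ∀ {la c r} → IsColumn la c r → r ≤ length (proj₁ la)
column-height≤length {la} (tall , _) =
  ≮⇒≥ λ len<r → n≮0 (<-≤-trans (tall len<r) (≤-reflexive (row-beyond (proj₁ la) ≤-refl)))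

-- Arm and leg add up to (λ_a - c) + (r - a - 1), the difference of the positions λ_a + N - a - 1
-- and c + N - r.
hook-difference : ∀ {N la a c r p q} → IsColumn la c r → c < part la a →
                  p + suc a ≡ part la a + N → q + r ≡ c + N → q + hook la (a , c) ≡ p
hook-difference {N} {la} {a} {c} {r} {p} {q} col c<la bead gap =
  lia 9 (λ q h p a l N r c d → con 1 :+ a :+ d :≡ r ⇒ c :+ h :≡ l ⇒
      p :+ (con 1 :+ a) :≡ l :+ N ⇒ q :+ r :≡ c :+ N ⇒ ⊢ q :+ (h :+ d) :≡ p)
    q (part la a ∸ c) p a (part la a) N r c
      (countCol (proj₁ la) c (suc a) (length (proj₁ la)))
    (trans (cong (suc a +_) (countCol-column {la} col (suc a) _
              (≤-trans (column-height≤length {la} col) (m≤n+m _ (suc a)))))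
           (m+[n∸m]≡n (row-in-column {la} col c<la)))
    (m+[n∸m]≡n (<⇒≤ c<la)) bead gap

box-of-bead-and-gap : ∀ {N la a c r p q} → IsColumn la c r →
  p + suc a ≡ part la a + N → q + r ≡ c + N → q < p → c < part la a
box-of-bead-and-gap {N} {la} {a} {c} {r} {p} {q} (tall , la≤c) bead gap q<p with a <? r
... | yes a<r = tall a<r
... | no a≮r = lia 7 (λ p a l N q r c → p :+ (con 1 :+ a) :≡ l :+ N ⇒ q :+ r :≡ c :+ N ⇒ q :< p ⇒
  r :≤ a ⇒ ⊢ c :< l) p a (part la a) N q r c bead gap q<p (≮⇒≥ a≮r)

row-bead : ∀ {N la} → Fits N la → ∀ {i} → 0 < part la i →
           ∃[ p ] i < N × p + suc i ≡ part la i + N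
row-bead {N} {la} fits {i} 0<la =
  part la i + N ∸ suc i , i<N , m∸n+n≡m (≤-trans i<N (m≤n+m N _))
  where
  i<N : i < N
  i<N = nonempty-row<N {N} {la} fits 0<la

column-gap : ∀ {N la} → Fits N la → ∀ c →
             ∃[ q ] ∃[ r ] r ≤ N × IsColumn la c r × q + r ≡ c + N
column-gap {N} {la} fits c with column {N} {la} fits c
... | r , r≤N , col = c + N ∸ r , r , r≤N , col , m∸n+n≡m (≤-trans r≤N (m≤n+m N c))

module _ (ℓ : ℕ) (2<ℓ : 2 < ℓ) {N la} (fits : Fits N la) where

  open Abacus ℓ 2<ℓ

  -- The beads `b`, `b′` are the rows `a`, `x` and the gaps `g`, `g′` the columns `c`, `y`. A gap
  -- left of a bead is a box, so the three distances are hook lengths.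
  JM⇒separated : IsJM ℓ la → Separated (Bead N la)
  JM⇒separated jm {D = D} {d′} {d″} (a , a<N , bead) ¬Bg ¬Bg′ (x , x<N , bead″)
      refl eq′ refl ℓ∣D ℓ∤d′ ℓ∤d″
    with ¬bead⇒gap {N} {la} fits ¬Bg | ¬bead⇒gap {N} {la} fits ¬Bg′
  ... | c , r , r≤N , col , gap | y , r′ , r′≤N , col′ , gap′ =
    jm (a , c , x , y , box , box′ , box″
       , subst (ℓ ∣_) (sym (hook≡ col box bead gap refl)) ℓ∣D
       , (λ ℓ∣h → ℓ∤d′ (subst (ℓ ∣_) (hook≡ col′ box′ bead gap′ eq′) ℓ∣h))
       , (λ ℓ∣h → ℓ∤d″ (subst (ℓ ∣_) (hook≡ col box″ bead″ gap refl) ℓ∣h)))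
    where
    D≢0 : D ≢ 0
    D≢0 refl = ¬Bg (a , a<N , trans (cong (_+ suc a) (sym (+-identityʳ _))) bead)
    box : c < part la a
    box = box-of-bead-and-gap {N} {la} col bead gap (m<m+n _ (n≢0⇒n>0 D≢0))
    box′ : y < part la a
    box′ = box-of-bead-and-gap {N} {la} col′ bead gap′
             (<-≤-trans (m<m+n _ (∤⇒>0 ℓ∤d′)) (≤-reflexive eq′))
    box″ : c < part la x
    box″ = box-of-bead-and-gap {N} {la} col bead″ gap (m<m+n _ (∤⇒>0 ℓ∤d″))
    hook≡ : ∀ {d p q a c r} → IsColumn la c r → c < part la a →
            p + suc a ≡ part la a + N → q + r ≡ c + N → q + d ≡ p → hook la (a , c) ≡ d
    hook≡ {q = q} col box bead gap q+d≡p =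
      +-cancelˡ-≡ q _ _ (trans (hook-difference {N} {la} col box bead gap) (sym q+d≡p))

  separated⇒JM : Separated (Bead N la) → IsJM ℓ la
  separated⇒JM sep (a , b , x , y , box , box′ , box″ , ℓ∣h , ℓ∤h′ , ℓ∤h″)
    with row-bead {N} {la} fits (≤-<-trans z≤n box) | row-bead {N} {la} fits (≤-<-trans z≤n box″)
       | column-gap {N} {la} fits b | column-gap {N} {la} fits y
  ... | p , a<N , bead | p″ , x<N , bead″ | q , r , r≤N , col , gap | q′ , r′ , r′≤N , col′ , gap′ =
    sep (a , a<N , bead) (gap⇒¬bead {N} {la} (b , r , r≤N , col , gap))
      (gap⇒¬bead {N} {la} (y , r′ , r′≤N , col′ , gap′)) (x , x<N , bead″)
      (hook-difference {N} {la} col box bead gap) (hook-difference {N} {la} col′ box′ bead gap′)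
      (hook-difference {N} {la} col box″ bead″ gap) ℓ∣h ℓ∤h′ ℓ∤h″

-- Rim hooks

bead-row-injective : ∀ {N la p i j} → p + suc i ≡ part la i + N → p + suc j ≡ part la j + N → i ≡ j
bead-row-injective {N} {la} {p} {i} {j} bi bj with <-cmp i j
... | tri≈ _ i≡j _ = i≡j
... | tri< i<j _ _ = ⊥-elim
  (lia 6 (λ p i j li lj N → p :+ (con 1 :+ i) :≡ li :+ N ⇒ p :+ (con 1 :+ j) :≡ lj :+ N ⇒ i :< j ⇒
     lj :≤ li ⇒ ⊢⊥) p i j (part la i) (part la j) N bi bj i<j (part-anti la (<⇒≤ i<j)))
... | tri> _ _ j<i = ⊥-elim
  (lia 6 (λ p i j li lj N → p :+ (con 1 :+ i) :≡ li :+ N ⇒ p :+ (con 1 :+ j) :≡ lj :+ N ⇒ j :< i ⇒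
     li :≤ lj ⇒ ⊢⊥) p i j (part la i) (part la j) N bi bj j<i (part-anti la (<⇒≤ j<i)))

bead-order : ∀ {N la p q i j} → p + suc i ≡ part la i + N → q + suc j ≡ part la j + N → p < q → j < i
bead-order {N} {la} {p} {q} {i} {j} bi bj p<q = ≰⇒> λ i≤j →
  lia 7 (λ p q i j li lj N → p :+ (con 1 :+ i) :≡ li :+ N ⇒ q :+ (con 1 :+ j) :≡ lj :+ N ⇒ i :≤ j ⇒
    lj :≤ li ⇒ p :< q ⇒ ⊢⊥) p q i j (part la i) (part la j) N bi bj i≤j (part-anti la i≤j) p<q

-- The rim hook la / mu occupies the rows t, ..., u; every row but the last
-- overlaps the next one in exactly one column.
record Ribbon (la mu : Partition) (t u : ℕ) : Set where
  field
    t≤u    : t ≤ u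
    above  : ∀ {i} → i < t → part mu i ≡ part la i
    below  : ∀ {i} → u < i → part mu i ≡ part la i
    inner  : ∀ {i} → t ≤ i → i < u → part la (suc i) ≡ suc (part mu i)
    bottom : part mu u < part la u

  strict : ∀ {i} → t ≤ i → i ≤ u → part mu i < part la i
  strict {i} t≤i i≤u with <-cmp i u
  ... | tri< i<u _ _ =
    ≤-trans (≤-reflexive (sym (inner t≤i i<u))) (part-anti la (n≤1+n i))
  ... | tri≈ _ refl _ = bottom
  ... | tri> _ _ u<i = contradiction i≤u (<⇒≱ u<i)

  subset : mu ⊆D la
  subset i with i <? t | u <? i
  ... | yes i<t | _ = ≤-reflexive (above i<t)
  ... | no i≮t | yes u<i = ≤-reflexive (below u<i)
  ... | no i≮t | no u≮i = <⇒≤ (strict (≮⇒≥ i≮t) (≮⇒≥ u≮i))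

  rows : ∀ {x y} → skew la mu (x , y) → t ≤ x × x ≤ u
  rows {x} {y} (y<la , y≮mu) =
      (≮⇒≥ λ x<t → y≮mu (subst (y <_) (sym (above x<t)) y<la))
    , (≮⇒≥ λ u<x → y≮mu (subst (y <_) (sym (below u<x)) y<la))

  left-end : ∀ {i} → t ≤ i → i ≤ u → skew la mu (i , part mu i)
  left-end t≤i i≤u = strict t≤i i≤u , n≮n _

-- Summation by row index lets `la` and `mu`, which may have different numbers of rows, be compared
-- over one range.
Σ< : (ℕ → ℕ) → ℕ → ℕ
Σ< f zero    = 0
Σ< f (suc n) = Σ< f n + f n

Σ<-front : ∀ f n → Σ< f (suc n) ≡ f 0 + Σ< (f ∘ suc) n
Σ<-front f zero    = sym (+-identityʳ (f 0))
Σ<-front f (suc n) = trans (cong (_+ f (suc n)) (Σ<-front f n)) (+-assoc (f 0) _ _)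

Σ<-cong : ∀ {f g} n → (∀ {i} → i < n → f i ≡ g i) → Σ< f n ≡ Σ< g n
Σ<-cong zero    f≗g = refl
Σ<-cong (suc n) f≗g = cong₂ _+_ (Σ<-cong n (f≗g ∘ m<n⇒m<1+n)) (f≗g ≤-refl)

Σ<-0 : ∀ n → Σ< (λ _ → 0) n ≡ 0
Σ<-0 zero    = refl
Σ<-0 (suc n) = trans (+-identityʳ _) (Σ<-0 n)

sum-rows : ∀ xs n → (∀ {i} → n ≤ i → row xs i ≡ 0) → sum xs ≡ Σ< (row xs) n
sum-rows []       n       beyond = sym (trans (Σ<-cong n (λ _ → refl)) (Σ<-0 n))
sum-rows (x ∷ xs) zero    beyond =
  cong₂ _+_ (beyond {0} z≤n) (sum-rows xs 0 λ {i} _ → beyond {suc i} z≤n)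
sum-rows (x ∷ xs) (suc n) beyond =
  trans (cong (x +_) (sum-rows xs n λ n≤i → beyond (s≤s n≤i))) (sym (Σ<-front (row (x ∷ xs)) n))

module _ {la mu t u} (ribbon : Ribbon la mu t u) where
  open Ribbon ribbon

  private
    λ̂ μ̂ : ℕ → ℕ
    λ̂ = part la
    μ̂ = part mu

    -- The row lengths λ̂ i ∸ μ̂ i telescope.
    partial-size : ∀ {k} → t ≤′ k → k ≤ u →
      Σ< λ̂ (suc k) + μ̂ k + t ≡ Σ< μ̂ (suc k) + λ̂ t + k
    partial-size ≤′-refl _ =
      lia 5 (λ S T l m t → S :≡ T ⇒ ⊢ S :+ l :+ m :+ t :≡ T :+ m :+ l :+ t)
        (Σ< λ̂ t) (Σ< μ̂ t) (λ̂ t) (μ̂ t) t (Σ<-cong t (sym ∘ above))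
    partial-size {suc k} (≤′-step t≤k) k<u =
      lia 8 (λ S T m l k t l′ m′ → S :+ m :+ t :≡ T :+ l :+ k ⇒ l′ :≡ con 1 :+ m ⇒
          ⊢ S :+ l′ :+ m′ :+ t :≡ T :+ m′ :+ l :+ (con 1 :+ k))
        (Σ< λ̂ (suc k)) (Σ< μ̂ (suc k)) (μ̂ k) (λ̂ t) k t (λ̂ (suc k)) (μ̂ (suc k))
        (partial-size t≤k (<⇒≤ k<u)) (inner (≤′⇒≤ t≤k) k<u)

    remaining-size : ∀ {k} → suc u ≤′ k → Σ< λ̂ k + Σ< μ̂ (suc u) ≡ Σ< μ̂ k + Σ< λ̂ (suc u)
    remaining-size ≤′-refl = +-comm (Σ< λ̂ (suc u)) _
    remaining-size {suc k} (≤′-step u<k) =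
      lia 6 (λ S T S′ T′ l m → S :+ T′ :≡ T :+ S′ ⇒ m :≡ l ⇒ ⊢ S :+ l :+ T′ :≡ T :+ m :+ S′)
        (Σ< λ̂ k) (Σ< μ̂ k) (Σ< λ̂ (suc u)) (Σ< μ̂ (suc u)) (λ̂ k) (μ̂ k)
        (remaining-size u<k) (below (≤′⇒≤ u<k))

  -- Rearranged, the number of boxes is (λ_t - t) - (μ_u - u): the distance that the bead travels.
  ribbon-size : size la + part mu u + t ≡ size mu + part la t + u
  ribbon-size =
    lia 10 (λ s s′ S T S′ T′ m t l u → s :≡ S ⇒ s′ :≡ T ⇒ S :+ T′ :≡ T :+ S′ ⇒
        S′ :+ m :+ t :≡ T′ :+ l :+ u ⇒ ⊢ s :+ m :+ t :≡ s′ :+ l :+ u)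
      (size la) (size mu) (Σ< λ̂ n) (Σ< μ̂ n) (Σ< λ̂ (suc u)) (Σ< μ̂ (suc u)) (μ̂ u) t (λ̂ t) u
      (sum-rows (proj₁ la) n λ n≤i → row-beyond (proj₁ la) (≤-trans la≤n n≤i))
      (sum-rows (proj₁ mu) n λ n≤i → row-beyond (proj₁ mu) (≤-trans mu≤n n≤i))
      (remaining-size (≤⇒≤′ u<n)) (partial-size (≤⇒≤′ t≤u) ≤-refl)
    where
    n : ℕ
    n = suc u + (length (proj₁ la) + length (proj₁ mu))
    u<n : suc u ≤ n
    u<n = m≤m+n (suc u) _
    la≤n : length (proj₁ la) ≤ n
    la≤n = ≤-trans (m≤m+n _ _) (m≤n+m _ (suc u))
    mu≤n : length (proj₁ mu) ≤ n
    mu≤n = ≤-trans (m≤n+m _ _) (m≤n+m _ (suc u))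

  -- The upper left box needs `y ≥ part mu x`, but by `inner` the lower right one needs
  -- `suc y < suc (part mu x)`.
  ribbon-no2x2 : No2x2 (skew la mu)
  ribbon-no2x2 (x , y , box@(_ , y≮mu) , box-below , _ , (y+1<la , _)) =
    y≮mu (s≤s⁻¹ (subst (suc y <_) (inner (proj₁ (rows box)) (proj₂ (rows box-below))) y+1<la))

  private
    S : BoxSet
    S = skew la mu

    Path : Box → Box → Set
    Path = Star (λ v w → S v × S w × Neighbour v w)

    flip : ∀ {v w} → Path v w → Path w v
    flip = reverse λ { (Sv , Sw , n) → Sw , Sv , neighbour-sym n }
      where
      neighbour-sym : ∀ {v w} → Neighbour v w → Neighbour w v
      neighbour-sym (inj₁ (refl , inj₁ eq)) = inj₁ (refl , inj₂ eq)
      neighbour-sym (inj₁ (refl , inj₂ eq)) = inj₁ (refl , inj₁ eq)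
      neighbour-sym (inj₂ (refl , inj₁ eq)) = inj₂ (refl , inj₂ eq)
      neighbour-sym (inj₂ (refl , inj₂ eq)) = inj₂ (refl , inj₁ eq)

    to-left-end : ∀ {x y} → μ̂ x ≤′ y → S (x , y) → Path (x , y) (x , μ̂ x)
    to-left-end ≤′-refl _ = ε
    to-left-end {x} (≤′-step {n = y} mu≤y) Sxy@(y+1<la , _) =
      (Sxy , Sy , inj₁ (refl , inj₂ refl)) ◅ to-left-end mu≤y Sy
      where
      Sy : S (x , y)
      Sy = <-trans (n<1+n y) y+1<la , ≤⇒≯ (≤′⇒≤ mu≤y)

    descend : ∀ n {x} → x + n ≡ u → t ≤ x → Path (x , μ̂ x) (u , μ̂ u)
    descend zero {x} x+0≡u t≤x with trans (sym (+-identityʳ x)) x+0≡u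
    ... | refl = ε
    descend (suc n) {x} x+n≡u t≤x =
      (left-end t≤x (<⇒≤ x<u) , next , inj₂ (refl , inj₁ refl))
        ◅ (to-left-end (≤⇒≤′ (part-anti mu (n≤1+n x))) next
        ◅◅ descend n (trans (sym (+-suc x n)) x+n≡u) (m≤n⇒m≤1+n t≤x))
      where
      x<u : x < u
      x<u = ≤-trans (m≤m+n (suc x) n) (≤-reflexive (trans (sym (+-suc x n)) x+n≡u))
      next : S (suc x , μ̂ x)
      next = ≤-reflexive (sym (inner t≤x x<u)) , ≤⇒≯ (part-anti mu (n≤1+n x))

    to-bottom : ∀ {v} → S v → Path v (u , μ̂ u)
    to-bottom {x , y} Sv@(_ , y≮mu) with rows Sv
    ... | t≤x , x≤u = to-left-end (≤⇒≤′ (≮⇒≥ y≮mu)) Sv ◅◅ descend (u ∸ x) (m+[n∸m]≡n x≤u) t≤x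

  -- Every box is joined to the left end of row `u`: walk left to the end of the row, step down
  -- through the column shared with the next row, and repeat.
  ribbon-connected : Connected (skew la mu)
  ribbon-connected v w Sv Sw = to-bottom Sv ◅◅ flip (to-bottom Sw)

greatest : ∀ {P : ℕ → Set} → Decidable P → ∀ n → ∃[ m ] m < n × P m →
           (∀ {k} → n ≤ k → ¬ P k) → ∃[ m ] P m × (∀ {k} → m < k → ¬ P k)
greatest P? zero (_ , () , _)
greatest {P} P? (suc n) (m , m≤n , Pm) beyond with P? n
... | yes Pn = n , Pn , beyond
... | no ¬Pn = greatest P? n (m , ≤∧≢⇒< (s≤s⁻¹ m≤n) (λ { refl → ¬Pn Pm }) , Pm) later
  where
  later : ∀ {k} → n ≤ k → ¬ P k
  later {k} n≤k with n ≟ k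
  ... | yes refl = ¬Pn
  ... | no n≢k = beyond (≤∧≢⇒< n≤k n≢k)

-- A discrete intermediate value argument: the row index changes by at most one at each step.
crossing : ∀ {S : BoxSet} {x y x′ y′} i → Star (λ v w → S v × S w × Neighbour v w) (x , y) (x′ , y′) →
           x ≤ i → i < x′ → ∃[ c ] S (i , c) × S (suc i , c)
crossing i ε x≤i i<x = contradiction i<x (≤⇒≯ x≤i)
crossing {S} i (_◅_ {j = x₁ , y₁} (Sv , Sw , n) path) x≤i i<x′ with x₁ ≤? i
... | yes x₁≤i = crossing i path x₁≤i i<x′
crossing i ((Sv , Sw , inj₁ (refl , _)) ◅ path) x≤i i<x′ | no x≰i = contradiction x≤i x≰i
crossing {S} {x} i ((Sv , Sw , inj₂ (refl , inj₁ refl)) ◅ path) x≤i i<x′ | no x+1≰i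
  with ≤-antisym x≤i (s≤s⁻¹ (≰⇒> x+1≰i))
... | refl = _ , Sv , Sw
crossing i ((Sv , Sw , inj₂ (refl , inj₂ refl)) ◅ path) x≤i i<x′ | no x₁≰i =
  contradiction (≤-trans (n≤1+n _) x≤i) x₁≰i

-- `t` and `u` are the first and the last row that lose a box. In between, connectedness makes
-- consecutive rows overlap, and the absence of 2×2 squares bounds the overlap by one column.
rimHook⇒ribbon : ∀ {ℓ la mu} → 0 < ℓ → IsRimHook ℓ la mu → ∃[ t ] ∃[ u ] Ribbon la mu t u
rimHook⇒ribbon {ℓ} {la} {mu} 0<ℓ (mu⊆la , size≡ , connected , no2x2) = t , u , record
  { t≤u = t≤u
  ; above = λ i<t → unchanged (t-least i<t)
  ; below = λ u<i → unchanged (u-greatest u<i)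
  ; inner = inner
  ; bottom = u-shorter }
  where
  Shorter : ℕ → Set
  Shorter i = part mu i < part la i
  Shorter? : Decidable Shorter
  Shorter? i = part mu i <? part la i
  n : ℕ
  n = length (proj₁ la)
  unchanged : ∀ {i} → ¬ Shorter i → part mu i ≡ part la i
  unchanged {i} ¬s = ≤-antisym (mu⊆la i) (≮⇒≥ ¬s)
  some : ∃[ i ] i < n × Shorter i
  some with anyUpTo? Shorter? n
  ... | yes found = found
  ... | no none = contradiction (+-cancelˡ-≡ (size mu) ℓ 0
      (trans (trans (sym size≡) same-size) (sym (+-identityʳ _)))) (>⇒≢ 0<ℓ)
    where
    same-size : size la ≡ size mu
    same-size =
      trans (sum-rows (proj₁ la) n (row-beyond (proj₁ la)))
        (trans (Σ<-cong n (λ i<n → sym (unchanged λ s → none (_ , i<n , s))))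
          (sym (sum-rows (proj₁ mu) n
            (fits-⊆ {n} {la} {mu} mu⊆la (fits-length la)))))
  beyond : ∀ {k} → n ≤ k → ¬ Shorter k
  beyond n≤k s = n≮0 (subst (_ <_) (row-beyond (proj₁ la) n≤k) s)
  first = least Shorter? (proj₁ some) (proj₂ (proj₂ some))
  last = greatest Shorter? n some beyond
  t u : ℕ
  t = proj₁ first
  u = proj₁ last
  t-shorter : Shorter t
  t-shorter = proj₁ (proj₂ (proj₂ first))
  u-shorter : Shorter u
  u-shorter = proj₁ (proj₂ last)
  t-least : ∀ {i} → i < t → ¬ Shorter i
  t-least = proj₂ (proj₂ (proj₂ first))
  u-greatest : ∀ {i} → u < i → ¬ Shorter i
  u-greatest = proj₂ (proj₂ last)
  t≤u : t ≤ u
  t≤u = ≮⇒≥ λ u<t → u-greatest u<t t-shorter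
  inner : ∀ {i} → t ≤ i → i < u → part la (suc i) ≡ suc (part mu i)
  inner {i} t≤i i<u
    with crossing {skew la mu} i
           (connected (t , part mu t) (u , part mu u) (t-shorter , n≮n _) (u-shorter , n≮n _)) t≤i i<u
  ... | c , (_ , c≮mu) , (c<la , _) = ≤-antisym
    (≮⇒≥ λ wide → no2x2 (i , part mu i
      , (<-≤-trans (<-trans (n<1+n _) wide) (part-anti la (n≤1+n i)) , n≮n _)
      , (<-trans (n<1+n _) wide , ≤⇒≯ (part-anti mu (n≤1+n i)))
      , (<-≤-trans wide (part-anti la (n≤1+n i)) , ≤⇒≯ (n≤1+n _))
      , (wide , ≤⇒≯ (≤-trans (part-anti mu (n≤1+n i)) (n≤1+n _)))))
    (≤-<-trans (≮⇒≥ c≮mu) c<la)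

-- Rim hooks as bead moves

record Strip (N ℓ : ℕ) (la mu : Partition) (g x : ℕ) : Set where
  field
    {t u}  : ℕ
    ribbon : Ribbon la mu t u
    u<N    : u < N
    top    : x + suc t ≡ part la t + N
    end    : g + suc u ≡ part mu u + N
    length-ℓ : g + ℓ ≡ x

  open Ribbon ribbon public

  t<N : t < N
  t<N = ≤-<-trans t≤u u<N

  old-bead : Bead N la x
  old-bead = t , t<N , top

  new-bead : Bead N mu g
  new-bead = u , u<N , end

  old-gap : ¬ Bead N la g
  old-gap (i , i<N , bead) with i ≤? u
  ... | yes i≤u =
    lia 7 (λ g i l N u l′ m → g :+ (con 1 :+ i) :≡ l :+ N ⇒ g :+ (con 1 :+ u) :≡ m :+ N ⇒ i :≤ u ⇒
        m :< l′ ⇒ l′ :≤ l ⇒ ⊢⊥) g i (part la i) N u (part la u) (part mu u)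
      bead end i≤u bottom (part-anti la i≤u)
  ... | no i≰u =
    lia 7 (λ g i l N u m m′ → g :+ (con 1 :+ i) :≡ l :+ N ⇒ g :+ (con 1 :+ u) :≡ m :+ N ⇒ u :< i ⇒
        m′ :≡ l ⇒ m′ :≤ m ⇒ ⊢⊥) g i (part la i) N u (part mu u) (part mu i)
      bead end (≰⇒> i≰u) (below (≰⇒> i≰u)) (part-anti mu (<⇒≤ (≰⇒> i≰u)))

  -- By `inner`, the bead of row `suc i` in `la` is the bead of row `i` in `mu` for t ≤ i < u. So
  -- only the bead of row `t` leaves its place, and row `u` receives `g`.
  bead⇒moved : ∀ {p} → Bead N mu p → p ≡ g ⊎ (Bead N la p × p ≢ x)
  bead⇒moved {p} (i , i<N , bead) with i <? t
  ... | yes i<t = inj₂ ((i , i<N , bead′) ,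
      λ { refl → <⇒≢ i<t (bead-row-injective {N} {la} bead′ top) })
    where
    bead′ : p + suc i ≡ part la i + N
    bead′ = trans bead (cong (_+ N) (above i<t))
  ... | no i≮t with <-cmp i u
  ...   | tri< i<u _ _ = inj₂ ((suc i , ≤-<-trans i<u u<N , bead′) ,
      λ { refl → i≮t (≤-reflexive (bead-row-injective {N} {la} bead′ top)) })
    where
    bead′ : p + suc (suc i) ≡ part la (suc i) + N
    bead′ = trans (+-suc p (suc i)) (trans (cong suc bead) (cong (_+ N) (sym (inner (≮⇒≥ i≮t) i<u))))
  ...   | tri≈ _ refl _ = inj₁ (+-cancelʳ-≡ (suc u) p g (trans bead (sym end)))
  ...   | tri> _ _ u<i = inj₂ ((i , i<N , bead′) ,
      λ { refl → <⇒≢ (≤-<-trans t≤u u<i) (sym (bead-row-injective {N} {la} bead′ top)) })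
    where
    bead′ : p + suc i ≡ part la i + N
    bead′ = trans bead (cong (_+ N) (below u<i))

  moved⇒bead : ∀ {p} → p ≡ g ⊎ (Bead N la p × p ≢ x) → Bead N mu p
  moved⇒bead (inj₁ refl) = new-bead
  moved⇒bead {p} (inj₂ ((i , i<N , bead) , p≢x)) with <-cmp i t
  ... | tri< i<t _ _ = i , i<N , trans bead (cong (_+ N) (sym (above i<t)))
  ... | tri≈ _ refl _ = contradiction (+-cancelʳ-≡ (suc t) p x (trans bead (sym top))) p≢x
  moved⇒bead {p} (inj₂ ((suc i , i<N , bead) , p≢x)) | tri> _ _ (s≤s t≤i) with i <? u
  ... | yes i<u = i , <-trans (n<1+n i) i<N ,
    suc-injective (trans (sym (+-suc p (suc i))) (trans bead (cong (_+ N) (inner t≤i i<u))))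
  ... | no i≮u = suc i , i<N , trans bead (cong (_+ N) (sym (below (s≤s (≮⇒≥ i≮u)))))

  -- The position of a box is its content y - i, shifted; it is constant on diagonals, and the hook
  -- stays on the diagonals from `g` to x - 1.
  box-position : ∀ {i y p} → skew la mu (i , y) → p + suc i ≡ y + N → g ≤ p × p < x
  box-position {i} {y} {p} box@(y<la , y≮mu) pos with rows box
  ... | t≤i , i≤u =
      lia 8 (λ g p i y N u m m′ → p :+ (con 1 :+ i) :≡ y :+ N ⇒ g :+ (con 1 :+ u) :≡ m :+ N ⇒ i :≤ u ⇒
          m :≤ m′ ⇒ m′ :≤ y ⇒ ⊢ g :≤ p) g p i y N u (part mu u) (part mu i)
        pos end i≤u (part-anti mu i≤u) (≮⇒≥ y≮mu)
    , lia 8 (λ x p i y N t l l′ → p :+ (con 1 :+ i) :≡ y :+ N ⇒ x :+ (con 1 :+ t) :≡ l :+ N ⇒ t :≤ i ⇒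
          l′ :≤ l ⇒ y :< l′ ⇒ ⊢ p :< x) x p i y N t (part la t) (part la i)
        pos top t≤i (part-anti la t≤i) y<la

  position : ∀ {i y} → skew la mu (i , y) → ∃[ p ] p + suc i ≡ y + N × g ≤ p × p < x
  position {i} {y} box = y + N ∸ suc i , pos , box-position box pos
    where
    pos : y + N ∸ suc i + suc i ≡ y + N
    pos = m∸n+n≡m (≤-trans (≤-<-trans (proj₂ (rows box)) u<N) (m≤n+m N y))

  -- If the hook had a second row, the bead of row `suc t` would lie strictly between `g` and `x`.
  gaps⇒t≡u : between g x (λ p → ¬ Bead N la p) → t ≡ u
  gaps⇒t≡u gaps with <-cmp t u
  ... | tri≈ _ t≡u _ = t≡u
  ... | tri> _ _ u<t = contradiction t≤u (<⇒≱ u<t)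
  ... | tri< t<u _ _ = contradiction (suc t , ≤-<-trans t<u u<N , m∸n+n≡m t+2≤) (gaps p
      (lia 8 (λ p t l N g u l″ m → p :+ (con 1 :+ (con 1 :+ t)) :≡ l :+ N ⇒ g :+ (con 1 :+ u) :≡ m :+ N ⇒
         m :< l″ ⇒ l″ :≤ l ⇒ t :< u ⇒ ⊢ g :< p)
         p t (part la (suc t)) N g u (part la u) (part mu u)
         (m∸n+n≡m t+2≤) end bottom (part-anti la t<u) t<u)
      (lia 6 (λ p t l N x l′ → p :+ (con 1 :+ (con 1 :+ t)) :≡ l :+ N ⇒ x :+ (con 1 :+ t) :≡ l′ :+ N ⇒
         l :≤ l′ ⇒ ⊢ p :< x) p t (part la (suc t)) N x (part la t)
         (m∸n+n≡m t+2≤) top (part-anti la (n≤1+n t))))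
    where
    t+2≤ : suc (suc t) ≤ part la (suc t) + N
    t+2≤ = ≤-trans (≤-<-trans t<u u<N) (m≤n+m N _)
    p : ℕ
    p = part la (suc t) + N ∸ suc (suc t)

  gaps⇒horizontal : between g x (λ p → ¬ Bead N la p) → Horizontal (skew la mu)
  gaps⇒horizontal gaps = t , λ i y box → ≤-antisym
    (≤-trans (proj₂ (rows box)) (≤-reflexive (sym (gaps⇒t≡u gaps)))) (proj₁ (rows box))

  horizontal⇒gaps : Horizontal (skew la mu) → between g x (λ p → ¬ Bead N la p)
  horizontal⇒gaps (r , in-r) p g<p p<x (i , i<N , bead) with <-cmp i t
  ... | tri≈ _ refl _ = <⇒≢ p<x (+-cancelʳ-≡ (suc t) p x (trans bead (sym top)))
  ... | tri< i<t _ _ = <⇒≯ i<t (bead-order {N} {la} bead top p<x)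
  ... | tri> _ _ t<i =
    <⇒≯ u<i (bead-order {N} {mu} end (trans bead (cong (_+ N) (sym (below u<i)))) g<p)
    where
    u<i : u < i
    u<i = subst (_< i)
      (trans (in-r t _ (left-end ≤-refl t≤u)) (sym (in-r u _ (left-end t≤u ≤-refl)))) t<i

  -- A box of the hook right of column `part mu u` would put the gap of its column strictly between
  -- `g` and `x`.
  beads⇒vertical : Fits N la → between g x (Bead N la) → Vertical (skew la mu)
  beads⇒vertical fits beads = part mu u , λ i y box → ≤-antisym (≮⇒≥ (narrow box))
    (≤-trans (part-anti mu (proj₂ (rows box))) (≮⇒≥ (proj₂ box)))
    where
    narrow : ∀ {i y} → skew la mu (i , y) → ¬ part mu u < y
    narrow {i} {y} box@(y<la , _) mu<y with column-gap {N} {la} fits y | rows box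
    ... | q , r , r≤N , col@(tall , _) , gap | t≤i , i≤u =
      gap⇒¬bead {N} {la} (y , r , r≤N , col , gap) (beads q
        (lia 7 (λ q r y N g u m → q :+ r :≡ y :+ N ⇒ g :+ (con 1 :+ u) :≡ m :+ N ⇒ m :< y ⇒
           r :≤ con 1 :+ u ⇒ ⊢ g :< q) q r y N g u (part mu u) gap end mu<y r≤u+1)
        (lia 7 (λ q r y N x t l → q :+ r :≡ y :+ N ⇒ x :+ (con 1 :+ t) :≡ l :+ N ⇒ y :< l ⇒
           t :< r ⇒ ⊢ q :< x) q r y N x t (part la t) gap top
           (<-≤-trans y<la (part-anti la t≤i))
           (≤-<-trans t≤i (row-in-column {la} col y<la))))
      where
      r≤u+1 : r ≤ suc u
      r≤u+1 = ≮⇒≥ λ u+1<r → <⇒≱ (tall u+1<r)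
        (≤-trans (≤-reflexive (sym (below ≤-refl)))
          (≤-trans (part-anti mu (n≤1+n u)) (<⇒≤ mu<y)))

  vertical⇒beads : Vertical (skew la mu) → between g x (Bead N la)
  vertical⇒beads (c , in-c) p g<p p<x = i , ≤-<-trans i≤u u<N ,
    lia 7 (λ x t N c p d l → x :+ (con 1 :+ t) :≡ con 1 :+ c :+ N ⇒ p :+ d :≡ x ⇒ l :≡ con 1 :+ c ⇒
        ⊢ p :+ (con 1 :+ (t :+ d)) :≡ l :+ N) x t N c p (x ∸ p) (part la i)
      (trans top (cong (_+ N) (row-length ≤-refl t≤u))) (m+[n∸m]≡n (<⇒≤ p<x))
      (row-length (m≤m+n t _) i≤u)
    where
    i : ℕ
    -- Rows `t` to `u` all have length `suc c`, so their beads occupy consecutive places leftwards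
    -- from `x`.
    i = t + (x ∸ p)
    left : ∀ {i} → t ≤ i → i ≤ u → part mu i ≡ c
    left t≤i i≤u = in-c _ _ (left-end t≤i i≤u)
    row-length : ∀ {i} → t ≤ i → i ≤ u → part la i ≡ suc c
    row-length {i} t≤i i≤u with predecessor (≤-<-trans z≤n (strict t≤i i≤u))
    ... | y , y+1≡la = trans (sym y+1≡la) (cong suc (in-c i y
      (≤-reflexive y+1≡la , ≤⇒≯ (s≤s⁻¹ (≤-trans (strict t≤i i≤u) (≤-reflexive (sym y+1≡la)))))))
    i≤u : i ≤ u
    i≤u = lia 8 (λ x t N c p d g u → x :+ (con 1 :+ t) :≡ con 1 :+ c :+ N ⇒ p :+ d :≡ x ⇒ g :< p ⇒
        g :+ (con 1 :+ u) :≡ c :+ N ⇒ ⊢ t :+ d :≤ u) x t N c p (x ∸ p) g u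
      (trans top (cong (_+ N) (row-length ≤-refl t≤u))) (m+[n∸m]≡n (<⇒≤ p<x)) g<p
      (trans end (cong (_+ N) (left t≤u ≤-refl)))

rimHook⇒strip : ∀ {N ℓ la mu} → 0 < ℓ → Fits N la → IsRimHook ℓ la mu →
                ∃[ g ] ∃[ x ] Strip N ℓ la mu g x
rimHook⇒strip {N} {ℓ} {la} {mu} 0<ℓ fits rim@(_ , size≡ , _) with rimHook⇒ribbon {ℓ} {la} {mu} 0<ℓ rim
... | t , u , ribbon = g , x , record
  { ribbon = ribbon
  ; u<N = u<N
  ; top = top
  ; end = end
  ; length-ℓ = lia 10 (λ g ℓ x t u l m N s s′ → x :+ (con 1 :+ t) :≡ l :+ N ⇒
      g :+ (con 1 :+ u) :≡ m :+ N ⇒ s :+ m :+ t :≡ s′ :+ l :+ u ⇒ s :≡ s′ :+ ℓ ⇒ ⊢ g :+ ℓ :≡ x)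
      g ℓ x t u (part la t) (part mu u) N (size la) (size mu)
      top end (ribbon-size ribbon) size≡ }
  where
  open Ribbon ribbon
  u<N : u < N
  u<N = nonempty-row<N {N} {la} fits (≤-<-trans z≤n bottom)
  g x : ℕ
  g = part mu u + N ∸ suc u
  x = part la t + N ∸ suc t
  top : x + suc t ≡ part la t + N
  top = m∸n+n≡m (≤-trans (≤-<-trans t≤u u<N) (m≤n+m N _))
  end : g + suc u ≡ part mu u + N
  end = m∸n+n≡m (≤-trans u<N (m≤n+m N _))

strip⇒rimHook : ∀ {N ℓ la mu g x} → Strip N ℓ la mu g x → IsRimHook ℓ la mu
strip⇒rimHook {N} {ℓ} {la} {mu} {g} {x} strip =
  subset , size≡ , ribbon-connected ribbon , ribbon-no2x2 ribbon
  where
  open Strip strip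
  size≡ : size la ≡ size mu + ℓ
  size≡ = lia 10 (λ g ℓ x t u l m N s s′ → x :+ (con 1 :+ t) :≡ l :+ N ⇒
      g :+ (con 1 :+ u) :≡ m :+ N ⇒ s :+ m :+ t :≡ s′ :+ l :+ u ⇒ g :+ ℓ :≡ x ⇒ ⊢ s :≡ s′ :+ ℓ)
    g ℓ x t u (part la t) (part mu u) N (size la) (size mu)
    top end (ribbon-size ribbon) length-ℓ

-- Construction of the partition left after a bead move.

fromRows : (ℕ → ℕ) → ℕ → List ℕ
fromRows f zero = []
fromRows f (suc n) with f 0
-- Stopping at the first zero keeps all parts positive; an antitone `f` has only zeros from there
-- on.
... | zero  = []
... | suc k = suc k ∷ fromRows (f ∘ suc) n

Antitone : (ℕ → ℕ) → Set
Antitone f = ∀ i → f (suc i) ≤ f i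

antitone-0 : ∀ {f} → Antitone f → f 0 ≡ 0 → ∀ i → f i ≡ 0
antitone-0 anti f0≡0 zero    = f0≡0
antitone-0 anti f0≡0 (suc i) = n≤0⇒n≡0 (≤-trans (anti i) (≤-reflexive (antitone-0 anti f0≡0 i)))

row-fromRows : ∀ f n → Antitone f → f n ≡ 0 → ∀ i → row (fromRows f n) i ≡ f i
row-fromRows f zero    anti fn≡0 i = sym (antitone-0 anti fn≡0 i)
row-fromRows f (suc n) anti fn≡0 i with f 0 in f0
row-fromRows f (suc n) anti fn≡0 i       | zero  = sym (antitone-0 anti f0 i)
row-fromRows f (suc n) anti fn≡0 zero    | suc k = sym f0
row-fromRows f (suc n) anti fn≡0 (suc i) | suc k = row-fromRows (f ∘ suc) n (anti ∘ suc) fn≡0 i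

fromRows-positive : ∀ f n → All (0 <_) (fromRows f n)
fromRows-positive f zero = []
fromRows-positive f (suc n) with f 0
... | zero  = []
... | suc k = s≤s z≤n ∷ fromRows-positive (f ∘ suc) n

rows-linked : ∀ xs → Antitone (row xs) → Linked (λ a b → b ≤ a) xs
rows-linked []           anti = []
rows-linked (x ∷ [])     anti = [-]
rows-linked (x ∷ y ∷ xs) anti = anti 0 ∷ rows-linked (y ∷ xs) (anti ∘ suc)

fromRows-partition : ∀ f n → Antitone f → f n ≡ 0 → IsPartition (fromRows f n)
fromRows-partition f n anti fn≡0 = fromRows-positive f n , rows-linked _ λ i →
  subst₂ _≤_ (sym (row-fromRows f n anti fn≡0 (suc i))) (sym (row-fromRows f n anti fn≡0 i)) (anti i)

module _ {N ℓ la g x} (fits : Fits N la) (g+ℓ≡x : g + ℓ ≡ x) (0<ℓ : 0 < ℓ) where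

  -- The gap `g` is a column `c` of height `suc u`, and the bead `x` is a row `t`. Rows `t` to u - 1
  -- take the length of the next row less one, row `u` is cut back to `c`, and the others stay.
  removal : Bead N la x → ¬ Bead N la g → ∃[ mu ] Strip N ℓ la mu g x
  removal (t , t<N , top) ¬Bg with ¬bead⇒gap {N} {la} fits ¬Bg
  ... | c , zero , _ , col , gap = contradiction
    (row-in-column {la} {t} col (box-of-bead-and-gap {N} {la} col top gap
      (<-≤-trans (m<m+n g 0<ℓ) (≤-reflexive g+ℓ≡x)))) n≮0
  ... | c , suc u , u<N , (tall , low) , gap = mu , record
    { ribbon = record
      { t≤u = t≤u
      ; above = λ {i} i<t → trans (mu-row i) (f-above i<t)
      ; below = λ {i} u<i → trans (mu-row i) (f-below u<i)
      ; inner = λ {i} t≤i i<u → trans (f-inner t≤i i<u) (cong suc (sym (mu-row i)))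
      ; bottom = subst (_< part la u) (sym (trans (mu-row u) f-u)) (tall ≤-refl) }
    ; u<N = u<N
    ; top = top
    ; end = trans gap (cong (_+ N) (sym (trans (mu-row u) f-u)))
    ; length-ℓ = g+ℓ≡x }
    where
    t≤u : t ≤ u
    t≤u = s≤s⁻¹ (row-in-column {la} {t} {c} (tall , low)
      (box-of-bead-and-gap {N} {la} {t} {c} (tall , low) top gap
        (<-≤-trans (m<m+n g 0<ℓ) (≤-reflexive g+ℓ≡x))))
    f : ℕ → ℕ
    f i with i <? t | <-cmp i u
    ... | yes _ | _          = part la i
    ... | no _  | tri< _ _ _ = pred (part la (suc i))
    ... | no _  | tri≈ _ _ _ = c
    ... | no _  | tri> _ _ _ = part la i
    f-above : ∀ {i} → i < t → f i ≡ part la i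
    f-above {i} i<t with i <? t | <-cmp i u
    ... | yes _  | _ = refl
    ... | no i≮t | _ = contradiction i<t i≮t
    f-inner : ∀ {i} → t ≤ i → i < u → part la (suc i) ≡ suc (f i)
    f-inner {i} t≤i i<u with i <? t | <-cmp i u
    ... | yes i<t | _ = contradiction t≤i (<⇒≱ i<t)
    ... | no _ | tri< _ _ _ = sym (suc-pred _ {{>-nonZero (≤-<-trans z≤n (tall (s≤s i<u)))}})
    ... | no _ | tri≈ i≮u _ _ = contradiction i<u i≮u
    ... | no _ | tri> i≮u _ _ = contradiction i<u i≮u
    f-u : f u ≡ c
    f-u with u <? t | <-cmp u u
    ... | yes u<t | _ = contradiction t≤u (<⇒≱ u<t)
    ... | no _ | tri< u<u _ _ = contradiction u<u (n≮n u)
    ... | no _ | tri≈ _ _ _ = refl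
    ... | no _ | tri> _ _ u<u = contradiction u<u (n≮n u)
    f-below : ∀ {i} → u < i → f i ≡ part la i
    f-below {i} u<i with i <? t | <-cmp i u
    ... | yes i<t | _ = refl
    ... | no _ | tri< _ _ i≯u = contradiction u<i i≯u
    ... | no _ | tri≈ _ _ i≯u = contradiction u<i i≯u
    ... | no _ | tri> _ _ _ = refl
    f≤la : ∀ i → f i ≤ part la i
    f≤la i with i <? t | <-cmp i u
    ... | yes _ | _          = ≤-refl
    ... | no _  | tri< _ _ _ = ≤-trans pred[n]≤n (part-anti la (n≤1+n i))
    ... | no _  | tri≈ _ refl _ = <⇒≤ (tall ≤-refl)
    ... | no _  | tri> _ _ _ = ≤-refl
    f<la : ∀ {i} → t ≤ i → i ≤ u → f i < part la i
    f<la {i} t≤i i≤u with m≤n⇒m<n∨m≡n i≤u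
    ... | inj₁ i<u  = ≤-trans (≤-reflexive (sym (f-inner t≤i i<u))) (part-anti la (n≤1+n i))
    ... | inj₂ refl = ≤-trans (≤-reflexive (cong suc f-u)) (tall ≤-refl)
    anti : Antitone f
    anti i with i <? t | <-cmp i u
    ... | yes i<t | _ = ≤-trans (f≤la (suc i)) (part-anti la (n≤1+n i))
    ... | no i≮t | tri> _ _ u<i = ≤-trans (f≤la (suc i)) (part-anti la (n≤1+n i))
    ... | no i≮t | tri≈ _ refl _ = ≤-trans (≤-reflexive (f-below ≤-refl)) low
    ... | no i≮t | tri< i<u _ _ = <⇒≤pred (f<la (m≤n⇒m≤1+n (≮⇒≥ i≮t)) i<u)
    fN≡0 : f N ≡ 0
    fN≡0 = trans (f-below u<N) (fits ≤-refl)
    mu : Partition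
    mu = fromRows f N , fromRows-partition f N anti fN≡0
    mu-row : ∀ i → part mu i ≡ f i
    mu-row = row-fromRows f N anti fN≡0

-- Generalized ℓ-partitions

neighbour-positions : ∀ {N i y i′ y′ p q} → Neighbour (i , y) (i′ , y′) →
  p + suc i ≡ y + N → q + suc i′ ≡ y′ + N → suc p ≡ q ⊎ suc q ≡ p
neighbour-positions {N} {i} {y} {p = p} {q} (inj₁ (refl , inj₁ refl)) pos pos′ = inj₁
  (lia 5 (λ p q i y N → p :+ (con 1 :+ i) :≡ y :+ N ⇒ q :+ (con 1 :+ i) :≡ con 1 :+ y :+ N ⇒
     ⊢ con 1 :+ p :≡ q) p q i y N pos pos′)
neighbour-positions {N} {i} {y′ = y′} {p} {q} (inj₁ (refl , inj₂ refl)) pos pos′ = inj₂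
  (lia 5 (λ p q i y N → p :+ (con 1 :+ i) :≡ con 1 :+ y :+ N ⇒ q :+ (con 1 :+ i) :≡ y :+ N ⇒
     ⊢ con 1 :+ q :≡ p) p q i y′ N pos pos′)
neighbour-positions {N} {i} {y} {p = p} {q} (inj₂ (refl , inj₁ refl)) pos pos′ = inj₂
  (lia 5 (λ p q i y N → p :+ (con 1 :+ i) :≡ y :+ N ⇒ q :+ (con 1 :+ (con 1 :+ i)) :≡ y :+ N ⇒
     ⊢ con 1 :+ q :≡ p) p q i y N pos pos′)
neighbour-positions {N} {y = y} {i′ = i} {p = p} {q} (inj₂ (refl , inj₂ refl)) pos pos′ = inj₁
  (lia 5 (λ p q i y N → p :+ (con 1 :+ (con 1 :+ i)) :≡ y :+ N ⇒ q :+ (con 1 :+ i) :≡ y :+ N ⇒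
     ⊢ con 1 :+ p :≡ q) p q i y N pos pos′)

-- Neighbouring boxes lie on neighbouring diagonals; this consequence of adjacency is all that the
-- proof of condition (2) draws on.
adjacent-positions : ∀ {N ℓ la mu nu g₁ x₁ g₂ x₂} →
  Strip N ℓ la mu g₁ x₁ → Strip N ℓ mu nu g₂ x₂ → Adjacent (skew la mu) (skew mu nu) →
  ∃[ p ] ∃[ q ] (g₁ ≤ p × p < x₁) × (g₂ ≤ q × q < x₂) × (suc p ≡ q ⊎ suc q ≡ p)
adjacent-positions s₁ s₂ (_ , _ , box₁ , box₂ , n)
  with Strip.position s₁ box₁ | Strip.position s₂ box₂
... | p , pos₁ , in₁ | q , pos₂ , in₂ = p , q , in₁ , in₂ , neighbour-positions n pos₁ pos₂

module _ {N ℓ : ℕ} {la mu nu : Partition} {g m b : ℕ} where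

  -- The second hook is a single row, directly above the top row of the first. The last box of that
  -- top row lies under the left end of the second hook.
  below-adjacent : (s₁ : Strip N ℓ la mu g m) (s₂ : Strip N ℓ mu nu m b) → g < m → m < b →
                   between m b (λ p → ¬ Bead N la p) → Adjacent (skew la mu) (skew mu nu)
  below-adjacent s₁ s₂ g<m m<b gaps with S₁.bead⇒moved S₂.old-bead
    where
    module S₁ = Strip s₁
    module S₂ = Strip s₂
  ... | inj₁ b≡g = contradiction b≡g (>⇒≢ (<-trans g<m m<b))
  ... | inj₂ ((s , s<N , bead) , _) =
    (S₁.t , y) , (S₂.u , y) , (y<la , y≮mu) , S₂.left-end S₂.t≤u ≤-refl ,
      inj₂ (refl , inj₂ u₂+1≡t₁)
    where
    module S₁ = Strip s₁
    module S₂ = Strip s₂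
    y : ℕ
    y = part nu S₂.u
    s<t₁ : s < S₁.t
    s<t₁ = bead-order {N} {la} S₁.top bead m<b
    s≡t₂ : s ≡ S₂.t
    s≡t₂ = bead-row-injective {N} {mu} (trans bead (cong (_+ N) (sym (S₁.above s<t₁)))) S₂.top
    t₂≡u₂ : S₂.t ≡ S₂.u
    t₂≡u₂ = S₂.gaps⇒t≡u λ p m<p p<b Mp → still-gap m<p p<b (S₁.bead⇒moved Mp)
      where
      still-gap : ∀ {p} → m < p → p < b → ¬ (p ≡ g ⊎ (Bead N la p × p ≢ m))
      still-gap m<p p<b (inj₁ refl)     = <⇒≱ m<p (<⇒≤ g<m)
      still-gap m<p p<b (inj₂ (Lp , _)) = gaps _ m<p p<b Lp
    -- A row between `s` and `S₁.t` would have its bead between `m` and `b`.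
    s+1≡t₁ : suc s ≡ S₁.t
    s+1≡t₁ = ≤-antisym s<t₁ (≮⇒≥ λ s+1<t₁ → gaps (p s+1<t₁)
      (lia 7 (λ p s l N m t l′ → p :+ (con 1 :+ (con 1 :+ s)) :≡ l :+ N ⇒ m :+ (con 1 :+ t) :≡ l′ :+ N ⇒
         l′ :≤ l ⇒ con 1 :+ s :< t ⇒ ⊢ m :< p) (p s+1<t₁) s (part la (suc s)) N m S₁.t (part la S₁.t)
         (pos s+1<t₁) S₁.top (part-anti la s<t₁) s+1<t₁)
      (lia 6 (λ p s l N b l′ → p :+ (con 1 :+ (con 1 :+ s)) :≡ l :+ N ⇒ b :+ (con 1 :+ s) :≡ l′ :+ N ⇒
         l :≤ l′ ⇒ ⊢ p :< b) (p s+1<t₁) s (part la (suc s)) N b (part la s)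
         (pos s+1<t₁) bead (part-anti la (n≤1+n s)))
      (suc s , <-trans s+1<t₁ S₁.t<N , pos s+1<t₁))
      where
      p : suc s < S₁.t → ℕ
      p _ = part la (suc s) + N ∸ suc (suc s)
      pos : (lt : suc s < S₁.t) → p lt + suc (suc s) ≡ part la (suc s) + N
      pos lt = m∸n+n≡m (≤-trans (≤-trans lt (<⇒≤ S₁.t<N)) (m≤n+m N _))
    u₂+1≡t₁ : suc S₂.u ≡ S₁.t
    u₂+1≡t₁ = trans (cong suc (trans (sym t₂≡u₂) (sym s≡t₂))) s+1≡t₁
    la≡y+1 : part la S₁.t ≡ suc y
    la≡y+1 = lia 6 (λ m t l N u y → m :+ (con 1 :+ t) :≡ l :+ N ⇒ m :+ (con 1 :+ u) :≡ y :+ N ⇒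
        con 1 :+ u :≡ t ⇒ ⊢ l :≡ con 1 :+ y) m S₁.t (part la S₁.t) N S₂.u y S₁.top S₂.end u₂+1≡t₁
    y<la : y < part la S₁.t
    y<la = ≤-reflexive (sym la≡y+1)
    y≮mu : ¬ y < part mu S₁.t
    y≮mu = ≤⇒≯ (s≤s⁻¹ (≤-trans (S₁.strict ≤-refl S₁.t≤u) (≤-reflexive la≡y+1)))

  -- The bead `m` of `mu` belongs both to the bottom row of the first hook and to the top row of the
  -- second, so in this row the second hook ends where the first begins.
  beside-adjacent : Strip N ℓ la mu m b → Strip N ℓ mu nu g m → Adjacent (skew la mu) (skew mu nu)
  beside-adjacent s₁ s₂ with predecessor (≤-<-trans z≤n (Strip.strict s₂ ≤-refl (Strip.t≤u s₂)))
  ... | y , y+1≡mu =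
    (S₁.u , part mu S₁.u) , (S₂.t , y) , S₁.left-end S₁.t≤u ≤-refl ,
      (≤-reflexive y+1≡mu
      , ≤⇒≯ (s≤s⁻¹ (≤-trans (S₂.strict ≤-refl S₂.t≤u) (≤-reflexive (sym y+1≡mu))))) ,
      inj₁ (u₁≡t₂ , inj₂ (trans y+1≡mu (cong (part mu) (sym u₁≡t₂))))
    where
    module S₁ = Strip s₁
    module S₂ = Strip s₂
    u₁≡t₂ : S₁.u ≡ S₂.t
    u₁≡t₂ = bead-row-injective {N} {mu} S₁.end S₂.top

module _ {ℓ : ℕ} (2<ℓ : 2 < ℓ) where

  open Abacus ℓ 2<ℓ

  private
    0<ℓ : 0 < ℓ
    0<ℓ = <-trans (s≤s z≤n) 2<ℓ

    shift< : ∀ {g x} → g + ℓ ≡ x → g < x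
    shift< {g} g+ℓ≡x = <-≤-trans (m<m+n g 0<ℓ) (≤-reflexive g+ℓ≡x)

  separated-resp : ∀ {B C} → (∀ {p} → B p → C p) → (∀ {p} → C p → B p) → Separated B → Separated C
  separated-resp B⇒C C⇒B sep Cb ¬Cg ¬Cg′ Cb′ =
    sep (C⇒B Cb) (¬Cg ∘ B⇒C) (¬Cg′ ∘ B⇒C) (C⇒B Cb′)

  module _ {B : ℕ → Set} (sep : Separated B) {g m b} (g+ℓ≡m : g + ℓ ≡ m) (m+ℓ≡b : m + ℓ ≡ b)
           (¬Bg : ¬ B g) (Bb : B b) where

    private
      two-steps : g + (ℓ + ℓ) ≡ b
      two-steps = trans (sym (+-assoc g ℓ ℓ)) (trans (cong (_+ ℓ) g+ℓ≡m) m+ℓ≡b)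

      ℓ-1+1≡ℓ : suc (pred ℓ) ≡ ℓ
      ℓ-1+1≡ℓ = suc-pred ℓ {{>-nonZero 0<ℓ}}

    -- Touching hooks of different directions occupy consecutive stretches from `g` to `m` and from
    -- `m` to `b`. The positions next to `g` and `m` already give a violation at distance 2ℓ; the
    -- two lemmas treat the two arrangements.
    no-outer-corner : B (suc g) → ¬ B (suc m) → ⊥
    no-outer-corner Bg+1 ¬Bm+1 = sep Bb ¬Bg ¬Bm+1 Bg+1 two-steps
      (lia 4 (λ m k ℓ b → con 1 :+ k :≡ ℓ ⇒ m :+ ℓ :≡ b ⇒ ⊢ con 1 :+ m :+ k :≡ b)
         m (pred ℓ) ℓ b ℓ-1+1≡ℓ m+ℓ≡b)
      (+-comm g 1) (∣m∣n⇒∣m+n ∣-refl ∣-refl) (∤-pred ∣-refl ℓ-1+1≡ℓ) ∤1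

    no-inner-corner : ¬ B (suc g) → B (suc m) → ⊥
    no-inner-corner ¬Bg+1 Bm+1 = sep Bb ¬Bg ¬Bg+1 Bm+1 two-steps
      (lia 4 (λ g k ℓ b → con 1 :+ k :≡ ℓ ⇒ g :+ (ℓ :+ ℓ) :≡ b ⇒ ⊢ con 1 :+ g :+ (ℓ :+ k) :≡ b)
         g (pred ℓ) ℓ b ℓ-1+1≡ℓ two-steps)
      (lia 3 (λ g ℓ m → g :+ ℓ :≡ m ⇒ ⊢ g :+ (ℓ :+ con 1) :≡ con 1 :+ m) g ℓ m g+ℓ≡m)
      (∣m∣n⇒∣m+n ∣-refl ∣-refl) (∤-+ ∣-refl (∤-pred ∣-refl ℓ-1+1≡ℓ)) (∤-+ ∣-refl ∤1)

  -- From separation to the conditions (1), (2) and (3).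

  separated-step : ∀ {N la mu g x} → Strip N ℓ la mu g x → Separated (Bead N la) → Separated (Bead N mu)
  separated-step {N} {la} strip sep =
    separated-resp moved⇒bead bead⇒moved
      (separated-moved (Bead? N la) length-ℓ old-bead old-gap sep)
    where open Strip strip

  separated⇒cond1 : ∀ {N la} → Fits N la → Separated (Bead N la) → Cond1 ℓ la
  separated⇒cond1 {N} {la} fits sep mu rim with rimHook⇒strip {N} {ℓ} {la} {mu} 0<ℓ fits rim
  ... | g , x , strip with separated⇒straight (Bead? N la) sep length-ℓ old-bead old-gap
    where open Strip strip
  ...   | inj₁ beads = inj₂ (Strip.beads⇒vertical strip fits beads)
  ...   | inj₂ gaps  = inj₁ (Strip.gaps⇒horizontal strip gaps)

  module _ {N la mu nu g₁ x₁ g₂ x₂} (sep : Separated (Bead N la))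
           (s₁ : Strip N ℓ la mu g₁ x₁) (s₂ : Strip N ℓ mu nu g₂ x₂) where

    private
      module S₁ = Strip s₁
      module S₂ = Strip s₂

      L M : ℕ → Set
      L = Bead N la
      M = Bead N mu

      M⇒L : ∀ {p} → M p → p ≢ g₁ → L p
      M⇒L Mp p≢g₁ with S₁.bead⇒moved Mp
      ... | inj₁ p≡g₁ = contradiction p≡g₁ p≢g₁
      ... | inj₂ (Lp , _) = Lp

      L⇒M : ∀ {p} → L p → p ≢ x₁ → M p
      L⇒M Lp p≢x₁ = S₁.moved⇒bead (inj₂ (Lp , p≢x₁))

      ¬Mx₁ : ¬ M x₁
      ¬Mx₁ Mx₁ with S₁.bead⇒moved Mx₁
      ... | inj₁ x₁≡g₁ = <⇒≢ (<-≤-trans (m<m+n g₁ 0<ℓ) (≤-reflexive S₁.length-ℓ)) (sym x₁≡g₁)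
      ... | inj₂ (_ , x₁≢x₁) = x₁≢x₁ refl

      next< : ∀ {g x} → g + ℓ ≡ x → suc g < x
      next< {g} {x} g+ℓ≡x =
        lia 3 (λ g ℓ x → g :+ ℓ :≡ x ⇒ con 2 :< ℓ ⇒ ⊢ con 1 :+ g :< x) g ℓ x g+ℓ≡x 2<ℓ

      next<₁ : suc g₁ < x₁
      next<₁ = next< S₁.length-ℓ

      next<₂ : suc g₂ < x₂
      next<₂ = next< S₂.length-ℓ

    -- In `mu` the positions from `g₁` to x₁ - 1 are beads and those from `g₂` to x₂ - 1 are gaps.
    -- The stretches are disjoint, so adjacency forces `g₂ ≡ x₁` or `x₂ ≡ g₁`, a corner in `la`
    -- either way.
    vertical-horizontal : Vertical (skew la mu) → Horizontal (skew mu nu) →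
                          ¬ Adjacent (skew la mu) (skew mu nu)
    vertical-horizontal vertical horizontal adjacent
      with adjacent-positions s₁ s₂ adjacent
    ... | p , q , (g₁≤p , p<x₁) , (g₂≤q , q<x₂) , next = meet next
      where
      bead₁ : ∀ {p} → g₁ ≤ p → p < x₁ → M p
      bead₁ {p} g₁≤p p<x₁ with m≤n⇒m<n∨m≡n g₁≤p
      ... | inj₁ g₁<p = L⇒M (S₁.vertical⇒beads vertical p g₁<p p<x₁) (<⇒≢ p<x₁)
      ... | inj₂ refl = S₁.new-bead
      gap₂ : ∀ {q} → g₂ ≤ q → q < x₂ → ¬ M q
      gap₂ {q} g₂≤q q<x₂ with m≤n⇒m<n∨m≡n g₂≤q
      ... | inj₁ g₂<q = S₂.horizontal⇒gaps horizontal q g₂<q q<x₂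
      ... | inj₂ refl = S₂.old-gap
      meet : suc p ≡ q ⊎ suc q ≡ p → ⊥
      meet (inj₁ refl) = no-outer-corner sep S₁.length-ℓ (trans (cong (_+ ℓ) (sym g₂≡x₁)) S₂.length-ℓ)
        S₁.old-gap
        (M⇒L S₂.old-bead (>⇒≢ (<-trans (≤-<-trans g₁≤p (n<1+n p)) q<x₂)))
        (S₁.vertical⇒beads vertical (suc g₁) ≤-refl next<₁)
        (λ Lx₁+1 → gap₂ (≤-trans (≤-reflexive g₂≡x₁) (n≤1+n x₁))
          (subst (λ z → suc z < x₂) g₂≡x₁ next<₂) (L⇒M Lx₁+1 1+n≢n))
        where
        p+1≡x₁ : suc p ≡ x₁
        p+1≡x₁ = ≤-antisym p<x₁ (≮⇒≥ λ p+1<x₁ → gap₂ g₂≤q q<x₂ (bead₁ (m≤n⇒m≤1+n g₁≤p) p+1<x₁))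
        g₂≡x₁ : g₂ ≡ x₁
        g₂≡x₁ = trans
          (≤-antisym g₂≤q (≰⇒> λ g₂≤p → gap₂ g₂≤p (<-trans (n<1+n p) q<x₂) (bead₁ g₁≤p p<x₁)))
          p+1≡x₁
      meet (inj₂ refl) = no-inner-corner sep S₂.length-ℓ (trans (cong (_+ ℓ) x₂≡g₁) S₁.length-ℓ)
        (λ Lg₂ → S₂.old-gap (L⇒M Lg₂ (<⇒≢ (≤-<-trans g₂≤q (<-trans (n<1+n q) p<x₁)))))
        S₁.old-bead
        (λ Lg₂+1 → S₂.horizontal⇒gaps horizontal (suc g₂) ≤-refl next<₂
          (L⇒M Lg₂+1 (<⇒≢ (<-trans next<₂ (subst (_< x₁) (sym x₂≡g₁) (≤-<-trans g₁≤p p<x₁))))))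
        (subst (λ z → L (suc z)) (sym x₂≡g₁) (S₁.vertical⇒beads vertical (suc g₁) ≤-refl next<₁))
        where
        q+1≡g₁ : suc q ≡ g₁
        q+1≡g₁ = ≤-antisym (≰⇒> λ g₁≤q → gap₂ g₂≤q q<x₂ (bead₁ g₁≤q (<-trans (n<1+n q) p<x₁))) g₁≤p
        x₂≡g₁ : x₂ ≡ g₁
        x₂≡g₁ = trans (≤-antisym (≮⇒≥ λ p<x₂ → gap₂ (m≤n⇒m≤1+n g₂≤q) p<x₂ (bead₁ g₁≤p p<x₁)) q<x₂) q+1≡g₁

    -- Here the stretches exclude their left ends and include their right ends: in `mu` the
    -- positions from g₁ + 1 to the vacated `x₁` are gaps, those from g₂ + 1 to `x₂` beads. Again
    -- adjacency makes them meet in a corner.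
    horizontal-vertical : Horizontal (skew la mu) → Vertical (skew mu nu) →
                          ¬ Adjacent (skew la mu) (skew mu nu)
    horizontal-vertical horizontal vertical adjacent
      with adjacent-positions s₁ s₂ adjacent
    ... | p , q , (g₁≤p , p<x₁) , (g₂≤q , q<x₂) , next = cases (<-cmp g₂ g₁)
      where
      gap₁ : ∀ {p} → g₁ < p → p ≤ x₁ → ¬ M p
      gap₁ {p} g₁<p p≤x₁ Mp with m≤n⇒m<n∨m≡n p≤x₁
      ... | inj₁ p<x₁ = S₁.horizontal⇒gaps horizontal p g₁<p p<x₁ (M⇒L Mp (>⇒≢ g₁<p))
      ... | inj₂ refl = ¬Mx₁ Mp
      bead₂ : ∀ {q} → g₂ < q → q ≤ x₂ → M q
      bead₂ {q} g₂<q q≤x₂ with m≤n⇒m<n∨m≡n q≤x₂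
      ... | inj₁ q<x₂ = S₂.vertical⇒beads vertical q g₂<q q<x₂
      ... | inj₂ refl = S₂.old-bead
      cases : Tri (g₂ < g₁) (g₂ ≡ g₁) (g₁ < g₂) → ⊥
      cases (tri≈ _ refl _) = S₂.old-gap S₁.new-bead
      cases (tri> _ _ g₁<g₂) =
        no-inner-corner sep S₁.length-ℓ (trans (cong (_+ ℓ) x₁≡g₂) S₂.length-ℓ) S₁.old-gap
          (M⇒L S₂.old-bead (>⇒≢ (<-trans g₁<g₂ (<-trans (n<1+n g₂) next<₂))))
          (S₁.horizontal⇒gaps horizontal (suc g₁) ≤-refl next<₁)
          (M⇒L (bead₂ (s≤s (≤-reflexive (sym x₁≡g₂)))
                      (subst (λ z → suc z ≤ x₂) (sym x₁≡g₂) (<⇒≤ next<₂)))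
            (>⇒≢ (<-trans (<-trans (n<1+n g₁) next<₁) (n<1+n x₁))))
        where
        x₁≤g₂ : x₁ ≤ g₂
        x₁≤g₂ = ≮⇒≥ λ g₂<x₁ → gap₁ (m<n⇒m<1+n g₁<g₂) g₂<x₁ (bead₂ ≤-refl (<⇒≤ next<₂))
        x₁≡g₂ : x₁ ≡ g₂
        x₁≡g₂ = close next
          where
          close : suc p ≡ q ⊎ suc q ≡ p → x₁ ≡ g₂
          close (inj₁ refl) = ≤-antisym x₁≤g₂ (≤-trans g₂≤q p<x₁)
          close (inj₂ refl) = contradiction (≤-trans (≤-trans x₁≤g₂ g₂≤q) (n≤1+n q)) (<⇒≱ p<x₁)
      cases (tri< g₂<g₁ _ _) =
        no-outer-corner sep S₂.length-ℓ (trans (cong (_+ ℓ) x₂≡g₁) S₁.length-ℓ)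
          (λ Lg₂ → S₂.old-gap (L⇒M Lg₂ (<⇒≢ (<-trans g₂<g₁ (<-trans (n<1+n g₁) next<₁)))))
          S₁.old-bead
          (M⇒L (bead₂ ≤-refl (<⇒≤ next<₂)) (<⇒≢ (<-≤-trans next<₂ (≤-reflexive x₂≡g₁))))
          (subst (λ z → ¬ L (suc z)) (sym x₂≡g₁)
            (S₁.horizontal⇒gaps horizontal (suc g₁) ≤-refl next<₁))
        where
        x₂≤g₁ : x₂ ≤ g₁
        x₂≤g₁ = ≮⇒≥ λ g₁<x₂ → gap₁ ≤-refl (<⇒≤ next<₁) (bead₂ (m<n⇒m<1+n g₂<g₁) g₁<x₂)
        x₂≡g₁ : x₂ ≡ g₁
        x₂≡g₁ = close next
          where
          close : suc p ≡ q ⊎ suc q ≡ p → x₂ ≡ g₁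
          close (inj₂ refl) = ≤-antisym x₂≤g₁ (≤-trans g₁≤p q<x₂)
          close (inj₁ refl) = contradiction (≤-trans (≤-trans x₂≤g₁ g₁≤p) (n≤1+n p)) (<⇒≱ q<x₂)

  separated⇒cond2 : ∀ {N la} → Fits N la → Separated (Bead N la) → Cond2 ℓ la
  separated⇒cond2 {N} {la} fits sep mu nu rim₁@(mu⊆la , _) rim₂ shapes
    with rimHook⇒strip {N} {ℓ} {la} {mu} 0<ℓ fits rim₁
       | rimHook⇒strip {N} {ℓ} {mu} {nu} 0<ℓ (fits-⊆ {N} {la} {mu} mu⊆la fits) rim₂
  ... | g₁ , x₁ , s₁ | g₂ , x₂ , s₂ with shapes
  ...   | inj₁ (vertical , horizontal) = vertical-horizontal sep s₁ s₂ vertical horizontal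
  ...   | inj₂ (horizontal , vertical) = horizontal-vertical sep s₁ s₂ horizontal vertical

  separated⇒generalized : ∀ {N la} → Fits N la → Separated (Bead N la) → IsGeneralized ℓ la
  separated⇒generalized {N} {la} fits sep .la ε =
    separated⇒cond1 {N} {la} fits sep , separated⇒cond2 {N} {la} fits sep
  separated⇒generalized {N} {la} fits sep nu (_◅_ {j = mu} (rim@(mu⊆la , _) , _) path)
    with rimHook⇒strip {N} {ℓ} {la} {mu} 0<ℓ fits rim
  ... | _ , _ , strip =
    separated⇒generalized (fits-⊆ {N} {la} {mu} mu⊆la fits) (separated-step strip sep) nu path

  -- From the conditions (1), (2) and (3) to separation.

  module _ {N la} (fits : Fits N la) (gen : IsGeneralized ℓ la) where

    private
      L : ℕ → Set
      L = Bead N la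

    generalized⇒straight : Straight L
    generalized⇒straight {g} {x} g+ℓ≡x Lx ¬Lg with removal {N} {ℓ} {la} fits g+ℓ≡x 0<ℓ Lx ¬Lg
    ... | mu , strip with proj₁ (gen la ε) mu (strip⇒rimHook strip)
    ...   | inj₁ horizontal = inj₂ (Strip.horizontal⇒gaps strip horizontal)
    ...   | inj₂ vertical   = inj₁ (Strip.vertical⇒beads strip vertical)

    -- Condition (1) makes every bead move an admissible removal, so the induction may use any of
    -- them.
    removeHV : ∀ {mu g x} → Strip N ℓ la mu g x → RemoveHV ℓ la mu
    removeHV {mu} strip = strip⇒rimHook strip , proj₁ (gen la ε) mu (strip⇒rimHook strip)

    generalized-step : ∀ {mu} → RemoveHV ℓ la mu → IsGeneralized ℓ mu
    generalized-step step nu path = gen nu (step ◅ path)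

    -- If `m` is a bead, it first moves to `g`, a vertical hook, and `b` then follows to `m`, a
    -- horizontal one. If `m` is a gap, `b` moves to `m` and from there to `g`. Both pairs of hooks
    -- are adjacent.
    generalized⇒noCorner : NoCorner L
    generalized⇒noCorner {g} {m} {b} g+ℓ≡m m+ℓ≡b ¬Lg Lb beads gaps with Bead? N la m
    ... | yes Lm with removal {N} {ℓ} {la} fits g+ℓ≡m 0<ℓ Lm ¬Lg
    ...   | mu , s₁ with removal {N} {ℓ} {mu} (fits-⊆ {N} {la} {mu} (Strip.subset s₁) fits) m+ℓ≡b 0<ℓ
                           (Strip.moved⇒bead s₁ (inj₂ (Lb , >⇒≢ (shift< m+ℓ≡b))))
                           (¬moved (>⇒≢ (shift< g+ℓ≡m)) ∘ Strip.bead⇒moved s₁)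
      where
      ¬moved : m ≢ g → ¬ (m ≡ g ⊎ (L m × m ≢ m))
      ¬moved m≢g (inj₁ m≡g)       = m≢g m≡g
      ¬moved m≢g (inj₂ (_ , m≢m)) = m≢m refl
    ...     | nu , s₂ =
      proj₂ (gen la ε) mu nu (strip⇒rimHook s₁) (strip⇒rimHook s₂)
        (inj₁ (Strip.beads⇒vertical s₁ fits beads , Strip.gaps⇒horizontal s₂ gaps′))
        (below-adjacent s₁ s₂ (shift< g+ℓ≡m) (shift< m+ℓ≡b) gaps)
      where
      gaps′ : between m b (λ p → ¬ Bead N mu p)
      gaps′ p m<p p<b Mp with Strip.bead⇒moved s₁ Mp
      ... | inj₁ refl     = <⇒≱ m<p (<⇒≤ (shift< g+ℓ≡m))
      ... | inj₂ (Lp , _) = gaps p m<p p<b Lp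
    generalized⇒noCorner {g} {m} {b} g+ℓ≡m m+ℓ≡b ¬Lg Lb beads gaps | no ¬Lm
      with removal {N} {ℓ} {la} fits m+ℓ≡b 0<ℓ Lb ¬Lm
    ... | mu , s₁ with removal {N} {ℓ} {mu} (fits-⊆ {N} {la} {mu} (Strip.subset s₁) fits) g+ℓ≡m 0<ℓ
                         (Strip.new-bead s₁) (¬moved ∘ Strip.bead⇒moved s₁)
      where
      ¬moved : ¬ (g ≡ m ⊎ (L g × g ≢ b))
      ¬moved (inj₁ g≡m)      = <⇒≢ (shift< g+ℓ≡m) g≡m
      ¬moved (inj₂ (Lg , _)) = ¬Lg Lg
    ...   | nu , s₂ =
      proj₂ (gen la ε) mu nu (strip⇒rimHook s₁) (strip⇒rimHook s₂)
        (inj₂ (Strip.gaps⇒horizontal s₁ gaps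
             , Strip.beads⇒vertical s₂ (fits-⊆ {N} {la} {mu} (Strip.subset s₁) fits) beads′))
        (beside-adjacent s₁ s₂)
      where
      beads′ : between g m (Bead N mu)
      beads′ p g<p p<m =
        Strip.moved⇒bead s₁ (inj₂ (beads p g<p p<m , <⇒≢ (<-trans p<m (shift< m+ℓ≡b))))

  -- Induction on a bound for the size: a removal takes away ℓ > 0 boxes and leaves a generalized
  -- ℓ-partition, which supplies separation after every move.
  generalized⇒separated : ∀ n {N la} → size la < n → Fits N la → IsGeneralized ℓ la →
                          Separated (Bead N la)
  generalized⇒separated (suc n) {N} {la} size<n fits gen =
    straight⇒separated (Bead? N la) (generalized⇒straight fits gen) (generalized⇒noCorner fits gen)
      moved-separated
    where
    moved-separated : ∀ {g x} → g + ℓ ≡ x → Bead N la x → ¬ Bead N la g →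
                      Separated (Moved (Bead N la) x g)
    moved-separated {g} {x} g+ℓ≡x Lx ¬Lg with removal {N} {ℓ} {la} fits g+ℓ≡x 0<ℓ Lx ¬Lg
    ... | mu , strip = separated-resp (Strip.bead⇒moved strip) (Strip.moved⇒bead strip)
      (generalized⇒separated n {N} {mu}
        (≤-trans (m<m+n (size mu) 0<ℓ)
          (≤-trans (≤-reflexive (sym (proj₁ (proj₂ (strip⇒rimHook strip))))) (s≤s⁻¹ size<n)))
        (fits-⊆ {N} {la} {mu} (Strip.subset strip) fits)
        (generalized-step fits gen (removeHV fits gen strip)))

theorem2p6 : (ℓ : ℕ) → 2 < ℓ → (la : Partition) → IsJM ℓ la ⇔ IsGeneralized ℓ la
theorem2p6 ℓ 2<ℓ la = mk⇔
  (λ jm → separated⇒generalized 2<ℓ fits (JM⇒separated ℓ 2<ℓ {N} {la} fits jm))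
  (λ gen → separated⇒JM ℓ 2<ℓ {N} {la} fits
             (generalized⇒separated 2<ℓ (suc (size la)) ≤-refl fits gen))
  where
  N : ℕ
  N = length (proj₁ la)
  fits : Fits N la
  fits = fits-length la
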